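{- Let $k$ be a natural number. For all $n\geq 2^{k-1}k(2k-1)$, $$B_k^e(n)-B_k^o(n)=C_k^e(n+1)-C_k^o(n+1)=\tfrac12 D_{2k}(n+1).$$
   Context: All partitions are of positive integers into positive parts unless stated otherwise. $B_k^e(n)$ (resp. $B_k^o(n)$) is the number of partitions of $n$ having at least one odd part, with largest odd part $2\ell-1$, in which every part is odd except for at most $k-1$ even parts. These even parts are pairwise distinct, lie in $[2\ell+2,\,2\ell+2k-2]$, and their number is even (resp. odd). $C_k^e(n)$ (resp. $C_k^o(n)$) is the number of pairs $(\lambda,\ell)$ with $\ell\ge1$ and $\lambda$ a partition of $n$ satisfying three conditions: - $\lambda$ contains the part $2\ell$; - the parts of $\lambda$ not exceeding $\ell$ are pairwise distinct, while parts in $(\ell,2\ell]$ are unrestricted; - the parts larger than $2\ell$ are at most $k-1$ pairwise distinct even parts in $[2\ell+2,\,2\ell+2k-2]$, and their number is even (resp. odd). Equivalently, a partition admitting several choices of $\ell$ is counted once per choice, matching the generating function $\sum_{\ell\ge1}\frac{(-q;q)_\ell(\mp q^{2\ell+2};q^2)_{k-1}}{(q^{\ell+1};q)_\ell}q^{2\ell}$ for $C^e\pm C^o$. $D_j(n)$ is the number of partitions of $n$ into non-negative parts (the part $0$ is allowed) in which the smallest part appears exactly $j$ times and no other part is repeated. The convention is $D_j(0)=1$, and the generating function is $\sum_{n\ge0}D_j(n)q^n=\sum_{m\ge0}q^{mj}(-q^{m+1};q)_\infty$, where $(a;q)_N=\prod_{i=0}^{N-1}(1-aq^i)$. -}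

module Defs where

open import Data.Nat
open import Data.Empty using (⊥)
open import Data.List using (List; []; _∷_; length; filter; upTo; cartesianProduct; cartesianProductWith)
open import Data.List.Properties using (∷-injective; filter-accept; filter-reject)
open import Data.List.Membership.Propositional using (_∈_)
open import Data.List.Membership.Propositional.Properties
  using (∈-filter⁺; ∈-filter⁻; ∈-upTo⁺; ∈-cartesianProductWith⁺; ∈-cartesianProductWith⁻; ∈-cartesianProduct⁺)
open import Data.List.Membership.DecPropositional _≟_ using (_∈?_)
open import Data.List.Relation.Unary.All as All using (All; []; _∷_)
open import Data.List.Relation.Unary.AllPairs using ([]; _∷_)
open import Data.List.Relation.Unary.Any using (here; there)
open import Data.List.Relation.Unary.Linked using (Linked; linked?)
open import Data.List.Relation.Unary.Unique.Propositional using (Unique)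
open import Data.List.Relation.Unary.Unique.Propositional.Properties
  using (filter⁺; upTo⁺; cartesianProduct⁺; cartesianProductWith⁺)
open import Data.List.Relation.Unary.Unique.DecPropositional _≟_ using (unique?)
open import Data.Nat.ListAction using (sum)
open import Data.Nat.Properties
open import Data.Parity using (Parity; 0ℙ; 1ℙ)
import Data.Parity.Properties as ℙ
open import Data.Product using (∃; ∃-syntax; _×_; _,_; proj₁; proj₂)
open import Relation.Binary.PropositionalEquality using (_≡_; _≢_; refl; sym)
open import Relation.Nullary using (Dec; yes; no; ¬?; _×-dec_)
open import Relation.Nullary.Decidable using (map′)
open import Relation.Unary using (Pred; Decidable)
open import Level using (0ℓ)

-- A predicate with finitely many solutions, listed without repetition; the
-- number of solutions does not depend on the listing chosen.

record Enumeration {A : Set} (P : Pred A 0ℓ) : Set where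
  field
    elements : List A
    unique   : Unique elements
    sound    : ∀ {x} → x ∈ elements → P x
    complete : ∀ {x} → P x → x ∈ elements

#_ : {A : Set} {P : Pred A 0ℓ} → Enumeration P → ℕ
# e = length (Enumeration.elements e)

-- Partitions are weakly decreasing lists, so that each multiset of parts is
-- represented exactly once.

PartitionWithZeros : ℕ → Pred (List ℕ) 0ℓ
PartitionWithZeros n λs = Linked _≥_ λs × sum λs ≡ n

Partition : ℕ → Pred (List ℕ) 0ℓ
Partition n λs = PartitionWithZeros n λs × All (1 ≤_) λs

Even Odd : Pred ℕ 0ℓ
Even p = parity p ≡ 0ℙ
Odd  p = parity p ≡ 1ℙ

even? : Decidable Even
even? p = parity p ℙ.≟ 0ℙ

odd? : Decidable Odd
odd? p = parity p ℙ.≟ 1ℙ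

evenParts oddParts : List ℕ → List ℕ
evenParts = filter even?
oddParts  = filter odd?

partsAbove partsUpTo : ℕ → List ℕ → List ℕ
partsAbove m = filter (m <?_)
partsUpTo  m = filter (_≤? m)

Largest Smallest : ℕ → Pred (List ℕ) 0ℓ
Largest  m xs = m ∈ xs × All (_≤ m) xs
Smallest m xs = m ∈ xs × All (m ≤_) xs

-- The condition shared by B and C on the exceptional even parts; π is the
-- parity of their number.

Exceptional : ℕ → ℕ → Parity → Pred (List ℕ) 0ℓ
Exceptional k ℓ π xs =
  length xs ≤ k ∸ 1
  × Unique xs
  × All (λ p → 2 * ℓ + 2 ≤ p × p ≤ 2 * ℓ + 2 * k ∸ 2) xs
  × parity (length xs) ≡ π

BPartition : ℕ → Parity → ℕ → Pred (List ℕ) 0ℓ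
BPartition k π n λs =
  Partition n λs
  × ∃[ ℓ ] 1 ≤ ℓ
         × Largest (2 * ℓ ∸ 1) (oddParts λs)
         × Exceptional k ℓ π (evenParts λs)

CPair : ℕ → Parity → ℕ → Pred (List ℕ × ℕ) 0ℓ
CPair k π n (λs , ℓ) =
  Partition n λs
  × 1 ≤ ℓ
  × 2 * ℓ ∈ λs
  × Unique (partsUpTo ℓ λs)
  × All Even (partsAbove (2 * ℓ) λs)
  × Exceptional k ℓ π (partsAbove (2 * ℓ) λs)

-- For j ≥ 1 the zero parts need no special treatment: DPartition j 0 holds
-- only of the list of j zeros. For j = 0 the predicate is empty.

DPartition : ℕ → ℕ → Pred (List ℕ) 0ℓ
DPartition j n λs =
  PartitionWithZeros n λs
  × ∃[ m ] Smallest m λs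
         × length (filter (_≟ m) λs) ≡ j
         × Unique (filter (λ p → ¬? (p ≟ m)) λs)

partitionWithZeros? : ∀ n → Decidable (PartitionWithZeros n)
partitionWithZeros? n λs = linked? _≥?_ λs ×-dec (sum λs ≟ n)

partition? : ∀ n → Decidable (Partition n)
partition? n λs = partitionWithZeros? n λs ×-dec All.all? (1 ≤?_) λs

largest? : ∀ m → Decidable (Largest m)
largest? m xs = (m ∈? xs) ×-dec All.all? (_≤? m) xs

smallest? : ∀ m → Decidable (Smallest m)
smallest? m xs = (m ∈? xs) ×-dec All.all? (m ≤?_) xs

exceptional? : ∀ k ℓ π → Decidable (Exceptional k ℓ π)
exceptional? k ℓ π xs =
  (length xs ≤? k ∸ 1)
  ×-dec unique? xs
  ×-dec All.all? (λ p → (2 * ℓ + 2 ≤? p) ×-dec (p ≤? 2 * ℓ + 2 * k ∸ 2)) xs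
  ×-dec (parity (length xs) ℙ.≟ π)

∈⇒≤sum : ∀ {x} xs → x ∈ xs → x ≤ sum xs
∈⇒≤sum (x ∷ xs) (here refl)  = m≤m+n x (sum xs)
∈⇒≤sum (y ∷ xs) (there x∈xs) = ≤-trans (∈⇒≤sum xs x∈xs) (m≤n+m (sum xs) y)

part≤ : ∀ {n x} λs → PartitionWithZeros n λs → x ∈ λs → x ≤ n
part≤ λs (_ , refl) = ∈⇒≤sum λs

boundedDec : ∀ {P : Pred ℕ 0ℓ} b → Decidable P → (∀ {m} → P m → m ≤ b) → Dec (∃ P)
boundedDec b P? bound =
  map′ (λ (m , _ , p) → m , p) (λ (m , p) → m , s≤s (bound p) , p) (anyUpTo? P? (suc b))

ℓ≤2ℓ∸1 : ∀ ℓ → ℓ ≤ 2 * ℓ ∸ 1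
ℓ≤2ℓ∸1 zero    = z≤n
ℓ≤2ℓ∸1 (suc ℓ) = ≤-trans (s≤s (m≤m+n ℓ (ℓ + 0))) (≤-reflexive (sym (+-suc ℓ (ℓ + 0))))

ℓ≤2ℓ : ∀ ℓ → ℓ ≤ 2 * ℓ
ℓ≤2ℓ ℓ = m≤m+n ℓ (ℓ + 0)

bPartition? : ∀ k π n → Decidable (BPartition k π n)
bPartition? k π n λs = partition? n λs ×-dec
  boundedDec (sum λs)
    (λ ℓ → (1 ≤? ℓ) ×-dec largest? (2 * ℓ ∸ 1) (oddParts λs) ×-dec exceptional? k ℓ π (evenParts λs))
    (λ {ℓ} (_ , (2ℓ∸1∈ , _) , _) →
      ≤-trans (ℓ≤2ℓ∸1 ℓ) (∈⇒≤sum λs (proj₁ (∈-filter⁻ odd? 2ℓ∸1∈))))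

cPair? : ∀ k π n → Decidable (CPair k π n)
cPair? k π n (λs , ℓ) =
  partition? n λs
  ×-dec (1 ≤? ℓ)
  ×-dec (2 * ℓ ∈? λs)
  ×-dec unique? (partsUpTo ℓ λs)
  ×-dec All.all? even? (partsAbove (2 * ℓ) λs)
  ×-dec exceptional? k ℓ π (partsAbove (2 * ℓ) λs)

dPartition? : ∀ j n → Decidable (DPartition j n)
dPartition? j n λs = partitionWithZeros? n λs ×-dec
  boundedDec (sum λs)
    (λ m → smallest? m λs ×-dec (length (filter (_≟ m) λs) ≟ j)
                          ×-dec unique? (filter (λ p → ¬? (p ≟ m)) λs))
    (λ ((m∈λs , _) , _) → ∈⇒≤sum λs m∈λs)

cons : ℕ → List ℕ → List ℕ
cons = _∷_

-- All lists of length at most l with entries at most b.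
boundedLists : ℕ → ℕ → List (List ℕ)
boundedLists b zero    = [] ∷ []
boundedLists b (suc l) = [] ∷ cartesianProductWith cons (upTo (suc b)) (boundedLists b l)

[]∉cons : ∀ xs yss → All (λ zs → List.[] ≢ zs) (cartesianProductWith cons xs yss)
[]∉cons xs yss = All.tabulate λ { zs∈ refl → absurd zs∈ }
  where
  absurd : List.[] ∈ cartesianProductWith cons xs yss → ⊥
  absurd p with ∈-cartesianProductWith⁻ cons xs yss p
  ... | _ , _ , _ , _ , ()

boundedLists-unique : ∀ b l → Unique (boundedLists b l)
boundedLists-unique b zero    = [] ∷ []
boundedLists-unique b (suc l) =
  []∉cons (upTo (suc b)) (boundedLists b l)
  ∷ cartesianProductWith⁺ cons ∷-injective (upTo⁺ (suc b)) (boundedLists-unique b l)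

∈-boundedLists : ∀ b l {xs} → All (_≤ b) xs → length xs ≤ l → xs ∈ boundedLists b l
∈-boundedLists b zero    []         _         = here refl
∈-boundedLists b (suc l) []         _         = here refl
∈-boundedLists b (suc l) (x≤b ∷ xs≤b) (s≤s len) =
  there (∈-cartesianProductWith⁺ cons (∈-upTo⁺ (s≤s x≤b)) (∈-boundedLists b l xs≤b len))

length≤sum : ∀ {xs} → All (1 ≤_) xs → length xs ≤ sum xs
length≤sum []           = z≤n
length≤sum (1≤x ∷ 1≤xs) = +-mono-≤ 1≤x (length≤sum 1≤xs)

length≤count+sum : ∀ m xs → All (m ≤_) xs → length xs ≤ length (filter (_≟ m) xs) + sum xs
length≤count+sum m []       []           = z≤n
length≤count+sum m (x ∷ xs) (m≤x ∷ m≤xs) with x ≟ m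
... | yes x≡m rewrite filter-accept (_≟ m) {xs = xs} x≡m =
                s≤s (≤-trans (length≤count+sum m xs m≤xs)
                             (+-monoʳ-≤ (length (filter (_≟ m) xs)) (m≤n+m (sum xs) x)))
... | no  x≢m rewrite filter-reject (_≟ m) {xs = xs} x≢m =
              ≤-trans (+-mono-≤ (≤-trans (s≤s z≤n) (≤∧≢⇒< m≤x (λ m≡x → x≢m (sym m≡x))))
                                  (length≤count+sum m xs m≤xs))
                        (≤-reflexive (x∙yz≈y∙xz x (length (filter (_≟ m) xs)) (sum xs)))
  where open import Algebra.Properties.CommutativeSemigroup +-commutativeSemigroup using (x∙yz≈y∙xz)

partition∈ : ∀ {n λs} → Partition n λs → λs ∈ boundedLists n n
partition∈ {n} {λs} (p@(_ , refl) , pos) =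
  ∈-boundedLists n n (All.tabulate (part≤ λs p)) (length≤sum pos)

enumerate : ∀ {A : Set} {P : Pred A 0ℓ} → Decidable P → (xs : List A) → Unique xs →
            (∀ {x} → P x → x ∈ xs) → Enumeration P
enumerate P? xs u complete = record
  { elements = filter P? xs
  ; unique   = filter⁺ P? u
  ; sound    = λ x∈ → proj₂ (∈-filter⁻ P? {xs = xs} x∈)
  ; complete = λ p → ∈-filter⁺ P? (complete p) p
  }

bPartitions : ∀ k π n → Enumeration (BPartition k π n)
bPartitions k π n =
  enumerate (bPartition? k π n) (boundedLists n n) (boundedLists-unique n n)
    (λ (p , _) → partition∈ p)

cPairs : ∀ k π n → Enumeration (CPair k π n)
cPairs k π n =
  enumerate (cPair? k π n) (cartesianProduct (boundedLists n n) (upTo (suc n)))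
    (cartesianProduct⁺ (boundedLists-unique n n) (upTo⁺ (suc n)))
    (λ { {λs , ℓ} (p , _ , 2ℓ∈λs , _) →
      ∈-cartesianProduct⁺ (partition∈ p)
        (∈-upTo⁺ (s≤s (≤-trans (ℓ≤2ℓ ℓ) (part≤ λs (proj₁ p) 2ℓ∈λs)))) })

dPartitions : ∀ j n → Enumeration (DPartition j n)
dPartitions j n =
  enumerate (dPartition? j n) (boundedLists n (j + n)) (boundedLists-unique n (j + n))
    (λ { {λs} (p@(_ , refl) , m , (_ , m≤λs) , refl , _) →
      ∈-boundedLists n (j + n) (All.tabulate (part≤ λs p)) (length≤count+sum m λs m≤λs) })

Bᵉ Bᵒ Cᵉ Cᵒ : ℕ → ℕ → ℕ
Bᵉ k n = # bPartitions k 0ℙ n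
Bᵒ k n = # bPartitions k 1ℙ n
Cᵉ k n = # cPairs k 0ℙ n
Cᵒ k n = # cPairs k 1ℙ n

D : ℕ → ℕ → ℕ
D j n = # dPartitions j n

{-# OPTIONS --safe #-}
module Submission where

-- Write a_ℓ = 1/(q;q²)_ℓ and P = (-q;q)_∞ = 1/(q;q²)_∞. Since
-- (-q;q)_ℓ/(q^{ℓ+1};q)_ℓ = a_ℓ, the ℓ-th summands of the generating functions
-- of C_k and B_k differ by a factor q, which is the first equality.
-- The series C_k = Σ_ℓ q^{2ℓ} (q^{2ℓ+2};q²)_{k-1} a_ℓ and D_j satisfy
--   C_{k+1} = (1-q^{2k})(1-q^{2k+1}) C_k + q^{2k+1} (P - (q²;q²)_k)
--   D_{j+2} = (1-q^j)(1-q^{j+1}) D_j + 2 q^{j+1} P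
-- the former by telescoping T_ℓ = a_ℓ (q^{2ℓ+2};q²)_k. Hence the defects
-- R_k = D_{2k} - 2 C_k obey R_1 = 1+q and
--   R_{k+1} = (1-q^{2k})(1-q^{2k+1}) R_k + 2 q^{2k+1} (q²;q²)_k,
-- so R_k is a polynomial of degree at most k(2k-1).
-- Working modulo q^{L+1} replaces every infinite sum and product by a finite one.

open import Algebra.Bundles using (CommutativeRing)
open import Algebra.Solver.Ring.AlmostCommutativeRing using (fromCommutativeRing; _-Raw-AlmostCommutative⟶_)
open import Data.Integer.Base as ℤ using (ℤ; +_; 0ℤ; 1ℤ)
import Data.Integer.Properties as ℤ
open import Data.Maybe using (Maybe; just; nothing)
open import Data.Nat using (ℕ; zero; suc; _≤_; _<_; z≤n; s≤s)
import Data.Nat as ℕ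
import Data.Nat.Properties as ℕ
open import Function using (_∘_; id; case_of_)
open import Level using (0ℓ)
open import Relation.Nullary using (¬_; ¬?; yes; no; does; contradiction)
open import Relation.Binary.PropositionalEquality as ≡ using (_≡_)

-- The bound on n comes from the defect alone. P enters D_{2k+2} and 2 C_{k+1} with the same
-- coefficient 2q^{2k+1}, so it cancels and only finite products are left. The recurrence for D is
-- the twofold iterate of the simpler D_{j+1} + (1-q^j) D_j = 2P. The identities are proved in an
-- abstract commutative ring in which q^{L+1} vanishes and every 1-q^{i+1} has an inverse, so that a
-- ring solver settles each polynomial step. No limit is taken: L is chosen to be the coefficient
-- under study. The other half is the passage from lists to coefficients. The definitions of B, C
-- and D speak of whole lists, but once ℓ (or the smallest part m) is fixed, each amounts to
-- independent conditions on the multiplicities of the single part sizes, and this turns the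
-- generating function into a product. A signed count is attached to a predicate, not to a chosen
-- listing, so comparing two counts takes a logical equivalence and no bijection.

module Identities (R : CommutativeRing 0ℓ 0ℓ)
  (constants : CommutativeRing.rawRing ℤ.+-*-commutativeRing -Raw-AlmostCommutative⟶ fromCommutativeRing R)
  where

  open CommutativeRing R
  open import Algebra.Properties.Semiring.Exp semiring
  open import Algebra.Properties.CommutativeSemiring.Exp commutativeSemiring using (^-distrib-*)
  open _-Raw-AlmostCommutative⟶_ constants using (1-homo; 0-homo) renaming (⟦_⟧ to ⟪_⟫)
  open import Relation.Binary.Reasoning.Setoid setoid
  import Algebra.Solver.Ring as Solver

  private
    _≟_ : ∀ a b → Maybe (⟪ a ⟫ ≈ ⟪ b ⟫)
    a ≟ b with a ℤ.≟ b
    ... | yes ≡.refl = just refl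
    ... | no _       = nothing

  open Solver (CommutativeRing.rawRing ℤ.+-*-commutativeRing) (fromCommutativeRing R) constants _≟_
    using (solve; _:=_; _:+_; _:*_; _:-_; con)

  -- Finite sums and products in a commutative ring.

  ∏ ∑ : ℕ → (ℕ → Carrier) → Carrier
  ∏ zero    f = 1#
  ∏ (suc n) f = ∏ n f * f n
  ∑ zero    f = 0#
  ∑ (suc n) f = ∑ n f + f n

  ∏-cong : ∀ n {f g} → (∀ i → i < n → f i ≈ g i) → ∏ n f ≈ ∏ n g
  ∏-cong zero    p = refl
  ∏-cong (suc n) p = *-cong (∏-cong n λ i → p i ∘ ℕ.m<n⇒m<1+n) (p n ℕ.≤-refl)

  ∑-cong : ∀ n {f g} → (∀ i → i < n → f i ≈ g i) → ∑ n f ≈ ∑ n g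
  ∑-cong zero    p = refl
  ∑-cong (suc n) p = +-cong (∑-cong n λ i → p i ∘ ℕ.m<n⇒m<1+n) (p n ℕ.≤-refl)

  ∑-*ʳ : ∀ n f x → ∑ n f * x ≈ ∑ n (λ i → f i * x)
  ∑-*ʳ zero    f x = zeroˡ x
  ∑-*ʳ (suc n) f x = trans (distribʳ x (∑ n f) (f n)) (+-congʳ (∑-*ʳ n f x))

  ∏-ones : ∀ n {f} → (∀ i → i < n → f i ≈ 1#) → ∏ n f ≈ 1#
  ∏-ones zero    p = refl
  ∏-ones (suc n) p = trans (*-cong (∏-ones n λ i → p i ∘ ℕ.m<n⇒m<1+n) (p n ℕ.≤-refl)) (*-identityˡ 1#)

  ∏-head : ∀ n f → ∏ (suc n) f ≈ f 0 * ∏ n (f ∘ suc)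
  ∏-head zero    f = *-comm 1# (f 0)
  ∏-head (suc n) f = trans (*-congʳ (∏-head n f)) (*-assoc (f 0) (∏ n (f ∘ suc)) (f (suc n)))

  ∏-+ : ∀ m n f → ∏ (n ℕ.+ m) f ≈ ∏ m f * ∏ n (λ i → f (i ℕ.+ m))
  ∏-+ m zero    f = sym (*-identityʳ _)
  ∏-+ m (suc n) f = trans (*-congʳ (∏-+ m n f)) (*-assoc _ _ _)

  ∏-pairs : ∀ n f → ∏ (n ℕ.* 2) f ≈ ∏ n (λ i → f (i ℕ.* 2) * f (suc (i ℕ.* 2)))
  ∏-pairs zero    f = refl
  ∏-pairs (suc n) f = trans (*-assoc _ _ _) (*-congʳ (∏-pairs n f))

  -- Recurrences for the truncated series.

  module Sums (q : Carrier) (L : ℕ) (G : ℕ → Carrier)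
    (truncation : q ^ suc L ≈ 0#)
    (geometric : ∀ i → (⟪ 1ℤ ⟫ - q ^ suc i) * G i ≈ 1#)
    where

    -- The unit is written `⟪ 1ℤ ⟫`, the form in which the solver interprets its constants; `1-homo`
    -- converts to `1#` where necessary.
    1-q^ 1+q^ : ℕ → Carrier
    1-q^ n = ⟪ 1ℤ ⟫ - q ^ n
    1+q^ n = ⟪ 1ℤ ⟫ + q ^ n

    q^≈0 : ∀ i → q ^ (i ℕ.+ suc L) ≈ 0#
    q^≈0 i = trans (^-homo-* q i (suc L)) (trans (*-congˡ truncation) (zeroʳ (q ^ i)))

    1-q^≈1 : ∀ i → 1-q^ (i ℕ.+ suc L) ≈ 1#
    1-q^≈1 i = trans (+-congˡ (-‿cong (trans (q^≈0 i) (sym 0-homo))))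
                     (trans (solve 0 (con 1ℤ :- con 0ℤ := con 1ℤ) refl) 1-homo)

    -- With c = 2ℓ this is (q^{2ℓ+2};q²)_k.
    evens : ℕ → ℕ → Carrier
    evens k c = ∏ k (λ i → 1-q^ (2 ℕ.+ (i ℕ.* 2 ℕ.+ c)))

    -- G i inverts 1 - q^{i+1}, so that A ℓ is a_ℓ.
    A : ℕ → Carrier
    A ℓ = ∏ ℓ (λ i → G (i ℕ.* 2))

    distinct : ℕ → Carrier
    distinct n = ∏ n (λ i → 1+q^ (suc i))

    P : Carrier
    P = distinct L

    -- This is (-q;q)_ℓ/(q^{ℓ+1};q)_ℓ, the form in which counting C produces the factor a_ℓ.
    E : ℕ → Carrier
    E ℓ = distinct ℓ * ∏ ℓ (λ i → G (i ℕ.+ ℓ))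

    -- From ℓ to ℓ+1 the denominator loses 1-q^{ℓ+1} and gains 1-q^{2ℓ+1} and 1-q^{2ℓ+2}, while the
    -- numerator gains 1+q^{ℓ+1}. Since (1+q^{ℓ+1})(1-q^{ℓ+1}) = 1-q^{2ℓ+2}, only the new odd factor
    -- survives.
    E≈A : ∀ ℓ → E ℓ ≈ A ℓ
    E≈A zero    = *-identityˡ 1#
    E≈A (suc ℓ) = begin
      D * 1+q^ (suc ℓ) * H
        ≈⟨ *-congˡ (*-identityˡ H) ⟨
      D * 1+q^ (suc ℓ) * (1# * H)
        ≈⟨ *-congˡ (*-congʳ (geometric ℓ)) ⟨
      D * 1+q^ (suc ℓ) * (1-q^ (suc ℓ) * G ℓ * H)
        ≈⟨ solve 4 (λ d w g h → d :* (con 1ℤ :+ w) :* ((con 1ℤ :- w) :* g :* h)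
                              := d :* (con 1ℤ :- w :* w) :* (g :* h)) refl D (q ^ suc ℓ) (G ℓ) H ⟩
      D * (⟪ 1ℤ ⟫ - q ^ suc ℓ * q ^ suc ℓ) * (G ℓ * H)
        ≈⟨ *-congˡ shift ⟩
      D * (⟪ 1ℤ ⟫ - q ^ suc ℓ * q ^ suc ℓ) * (H₀ * G (ℓ ℕ.+ ℓ) * G (suc ℓ ℕ.+ ℓ))
        ≈⟨ *-congʳ (*-congˡ (+-congˡ (-‿cong (^-homo-* q (suc ℓ) (suc ℓ))))) ⟨
      D * 1-q^ (suc ℓ ℕ.+ suc ℓ) * (H₀ * G (ℓ ℕ.+ ℓ) * G (suc ℓ ℕ.+ ℓ))
        ≡⟨ ≡.cong₂ (λ a b → D * 1-q^ a * (H₀ * G b * G (suc b)))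
             (≡.cong suc (≡.trans (ℕ.+-suc ℓ ℓ) (≡.cong suc 2ℓ))) 2ℓ ⟩
      D * 1-q^ (suc (suc (ℓ ℕ.* 2))) * (H₀ * G (ℓ ℕ.* 2) * G (suc (ℓ ℕ.* 2)))
        ≈⟨ solve 5 (λ d w h a b → d :* w :* (h :* a :* b) := (d :* h) :* a :* (w :* b))
             refl D _ H₀ _ _ ⟩
      (D * H₀) * G (ℓ ℕ.* 2) * (1-q^ (suc (suc (ℓ ℕ.* 2))) * G (suc (ℓ ℕ.* 2)))
        ≈⟨ *-cong (*-congʳ (E≈A ℓ)) (geometric (suc (ℓ ℕ.* 2))) ⟩
      A (suc ℓ) * 1#
        ≈⟨ *-identityʳ _ ⟩
      A (suc ℓ) ∎
      where
      D = distinct ℓ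
      H₀ = ∏ ℓ (λ i → G (i ℕ.+ ℓ))
      H = ∏ (suc ℓ) (λ i → G (i ℕ.+ suc ℓ))
      2ℓ : ℓ ℕ.+ ℓ ≡ ℓ ℕ.* 2
      2ℓ = ≡.trans (≡.cong (ℓ ℕ.+_) (≡.sym (ℕ.+-identityʳ ℓ))) (ℕ.*-comm 2 ℓ)
      -- Both sides are the product of `G` over the indices ℓ, ..., 2ℓ+1, split at the front or at
      -- the back.
      shift : G ℓ * H ≈ H₀ * G (ℓ ℕ.+ ℓ) * G (suc ℓ ℕ.+ ℓ)
      shift = trans (*-congˡ (∏-cong (suc ℓ) λ i _ → reflexive (≡.cong G (ℕ.+-suc i ℓ))))
                    (sym (∏-head (suc ℓ) (λ i → G (i ℕ.+ ℓ))))

    -- Euler's theorem on distinct and odd parts modulo q^{L+1}: the denominators of `E L` have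
    -- exponents above L and become 1, which leaves (-q;q)_L.
    A≈P : A L ≈ P
    A≈P = trans (sym (E≈A L)) (trans (*-congˡ (∏-ones L λ i _ → large i)) (*-identityʳ P))
      where
      large : ∀ i → G (i ℕ.+ L) ≈ 1#
      large i = begin
        G (i ℕ.+ L)                        ≈⟨ *-identityˡ _ ⟨
        1# * G (i ℕ.+ L)                   ≈⟨ *-congʳ (1-q^≈1 i) ⟨
        1-q^ (i ℕ.+ suc L) * G (i ℕ.+ L)   ≡⟨ ≡.cong (λ m → 1-q^ m * G (i ℕ.+ L)) (ℕ.+-suc i L) ⟩
        1-q^ (suc (i ℕ.+ L)) * G (i ℕ.+ L) ≈⟨ geometric (i ℕ.+ L) ⟩
        1# ∎

    -- The summand of C_{κ+1} at ℓ = l+1, with a_ℓ in place of (-q;q)_ℓ/(q^{ℓ+1};q)_ℓ.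
    cTerm : ℕ → ℕ → Carrier
    cTerm κ l = q ^ (2 ℕ.+ l ℕ.* 2) * A (suc l) * evens κ (suc l ℕ.* 2)

    cSum : ℕ → Carrier
    cSum κ = ∑ L (cTerm κ)

    T : ℕ → ℕ → Carrier
    T κ ℓ = A ℓ * evens (suc κ) (ℓ ℕ.* 2)

    A-step : ∀ l → A l ≈ 1-q^ (suc (l ℕ.* 2)) * A (suc l)
    A-step l = sym (begin
      w * (A l * G (l ℕ.* 2)) ≈⟨ solve 3 (λ w a g → w :* (a :* g) := a :* (w :* g)) refl w (A l) _ ⟩
      A l * (w * G (l ℕ.* 2)) ≈⟨ *-congˡ (geometric (l ℕ.* 2)) ⟩
      A l * 1#                ≈⟨ *-identityʳ _ ⟩
      A l ∎)
      where w = 1-q^ (suc (l ℕ.* 2))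

    -- All four terms share the factor `A′` times `H`: T_l adds the first even factor to `H`, and
    -- T_{l+1} and the new summand add the last one. Dividing it out leaves a polynomial identity in
    -- q, u = q^{2l} and v = q^{2κ}.
    term-step : ∀ κ l →
      cTerm (suc κ) l + q ^ (3 ℕ.+ κ ℕ.* 2) * T κ l
      ≈ 1-q^ (2 ℕ.+ κ ℕ.* 2) * (1-q^ (3 ℕ.+ κ ℕ.* 2) * cTerm κ l) + q ^ (3 ℕ.+ κ ℕ.* 2) * T κ (suc l)
    term-step κ l = begin
      cTerm (suc κ) l + q ^ (3 ℕ.+ κ ℕ.* 2) * T κ l
        ≈⟨ +-cong (*-congˡ (*-congˡ last)) (*-congˡ (*-cong (A-step l) first)) ⟩
      q * (q * u) * A′ * (H * (⟪ 1ℤ ⟫ - q * (q * (q * (q * (v * u))))))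
      + q * (q * (q * v)) * (1-q^ (suc (l ℕ.* 2)) * A′ * (1-q^ (2 ℕ.+ l ℕ.* 2) * H))
        ≈⟨ solve 5 (λ q u v a h →
             q :* (q :* u) :* a :* (h :* (con 1ℤ :- q :* (q :* (q :* (q :* (v :* u))))))
             :+ q :* (q :* (q :* v)) :* ((con 1ℤ :- q :* u) :* a :* ((con 1ℤ :- q :* (q :* u)) :* h))
             := (con 1ℤ :- q :* (q :* v)) :* ((con 1ℤ :- q :* (q :* (q :* v))) :* (q :* (q :* u) :* a :* h))
             :+ q :* (q :* (q :* v)) :* (a :* (h :* (con 1ℤ :- q :* (q :* (q :* (q :* (v :* u))))))))
             refl q u v A′ H ⟩
      1-q^ (2 ℕ.+ κ ℕ.* 2) * (1-q^ (3 ℕ.+ κ ℕ.* 2) * cTerm κ l)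
      + q ^ (3 ℕ.+ κ ℕ.* 2) * (A′ * (H * (⟪ 1ℤ ⟫ - q * (q * (q * (q * (v * u)))))))
        ≈⟨ +-congˡ (*-congˡ (*-congˡ (*-congˡ last))) ⟨
      1-q^ (2 ℕ.+ κ ℕ.* 2) * (1-q^ (3 ℕ.+ κ ℕ.* 2) * cTerm κ l) + q ^ (3 ℕ.+ κ ℕ.* 2) * T κ (suc l) ∎
      where
      A′ = A (suc l)
      H = evens κ (suc l ℕ.* 2)
      u = q ^ (l ℕ.* 2)
      v = q ^ (κ ℕ.* 2)
      move : ∀ m → m ℕ.+ suc l ℕ.* 2 ≡ 2 ℕ.+ (m ℕ.+ l ℕ.* 2)
      move m = ≡.trans (ℕ.+-suc m _) (≡.cong suc (ℕ.+-suc m _))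
      last : 1-q^ (2 ℕ.+ (κ ℕ.* 2 ℕ.+ suc l ℕ.* 2)) ≈ ⟪ 1ℤ ⟫ - q * (q * (q * (q * (v * u))))
      last = trans (reflexive (≡.cong (λ m → 1-q^ (2 ℕ.+ m)) (move (κ ℕ.* 2))))
        (+-congˡ (-‿cong (*-congˡ (*-congˡ (*-congˡ (*-congˡ (^-homo-* q (κ ℕ.* 2) (l ℕ.* 2))))))))
      first : evens (suc κ) (l ℕ.* 2) ≈ 1-q^ (2 ℕ.+ l ℕ.* 2) * H
      first = trans (∏-head κ _) (*-congˡ (∏-cong κ λ i _ →
        reflexive (≡.cong (λ m → 1-q^ (2 ℕ.+ m)) (≡.sym (move (i ℕ.* 2))))))

    -- Stated for partial sums with the subtraction T_n − T_0 moved across.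
    sum-step : ∀ κ n →
      ∑ n (cTerm (suc κ)) + q ^ (3 ℕ.+ κ ℕ.* 2) * T κ 0
      ≈ 1-q^ (2 ℕ.+ κ ℕ.* 2) * (1-q^ (3 ℕ.+ κ ℕ.* 2) * ∑ n (cTerm κ)) + q ^ (3 ℕ.+ κ ℕ.* 2) * T κ n
    sum-step κ zero    = +-congʳ (sym (trans (*-congˡ (zeroʳ _)) (zeroʳ _)))
    sum-step κ (suc n) = begin
      s′ + c′ + w * T κ 0
        ≈⟨ solve 3 (λ s c t → s :+ c :+ t := s :+ t :+ c) refl s′ c′ (w * T κ 0) ⟩
      s′ + w * T κ 0 + c′
        ≈⟨ +-congʳ (sum-step κ n) ⟩
      a * (b * s) + w * T κ n + c′
        ≈⟨ solve 3 (λ s t c → s :+ t :+ c := s :+ (c :+ t)) refl (a * (b * s)) (w * T κ n) c′ ⟩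
      a * (b * s) + (c′ + w * T κ n)
        ≈⟨ +-congˡ (term-step κ n) ⟩
      a * (b * s) + (a * (b * c) + w * T κ (suc n))
        ≈⟨ solve 5 (λ a b s c t → a :* (b :* s) :+ (a :* (b :* c) :+ t) := a :* (b :* (s :+ c)) :+ t)
             refl a b s c (w * T κ (suc n)) ⟩
      a * (b * (s + c)) + w * T κ (suc n) ∎
      where
      s′ = ∑ n (cTerm (suc κ))
      c′ = cTerm (suc κ) n
      s = ∑ n (cTerm κ)
      c = cTerm κ n
      w = q ^ (3 ℕ.+ κ ℕ.* 2)
      a = 1-q^ (2 ℕ.+ κ ℕ.* 2)
      b = 1-q^ (3 ℕ.+ κ ℕ.* 2)

    T-limit : ∀ κ → T κ L ≈ P
    T-limit κ = trans (*-cong A≈P (∏-ones (suc κ) large)) (*-identityʳ P)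
      where
      large : ∀ i → i < suc κ → 1-q^ (2 ℕ.+ (i ℕ.* 2 ℕ.+ L ℕ.* 2)) ≈ 1#
      large i _ = trans (reflexive (≡.cong 1-q^ exponent)) (1-q^≈1 (suc (i ℕ.* 2 ℕ.+ L)))
        where
        exponent : 2 ℕ.+ (i ℕ.* 2 ℕ.+ L ℕ.* 2) ≡ suc (i ℕ.* 2 ℕ.+ L) ℕ.+ suc L
        exponent = ≡.cong suc (≡.sym (≡.trans (ℕ.+-suc _ L) (≡.cong suc (≡.trans (ℕ.+-assoc (i ℕ.* 2) L L)
          (≡.cong (i ℕ.* 2 ℕ.+_) (≡.trans (≡.cong (L ℕ.+_) (≡.sym (ℕ.+-identityʳ L))) (ℕ.*-comm 2 L)))))))

    -- The two ends of the telescoped sum are T_L = P and T_0 = (q²;q²)_{κ+1}.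
    C-step : ∀ κ → cSum (suc κ) ≈ 1-q^ (2 ℕ.+ κ ℕ.* 2) * (1-q^ (3 ℕ.+ κ ℕ.* 2) * cSum κ)
                             + q ^ (3 ℕ.+ κ ℕ.* 2) * P - q ^ (3 ℕ.+ κ ℕ.* 2) * evens (suc κ) 0
    C-step κ = begin
      cSum (suc κ)
        ≈⟨ solve 2 (λ c t → c := c :+ t :- t) refl (cSum (suc κ)) t ⟩
      cSum (suc κ) + t - t
        ≈⟨ +-cong (trans (sum-step κ L) (+-congˡ (*-congˡ (T-limit κ)))) (-‿cong (*-congˡ (*-identityˡ _))) ⟩
      _ ∎
      where t = q ^ (3 ℕ.+ κ ℕ.* 2) * T κ 0

    -- For k = 1 the sum telescopes by itself, because q^{2ℓ} a_ℓ = q (a_ℓ - a_{ℓ-1}).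
    C-zero : cSum 0 ≈ q * P - q
    C-zero = trans (partial L) (+-congʳ (*-congˡ A≈P))
      where
      partial : ∀ n → ∑ n (cTerm 0) ≈ q * A n - q
      partial zero    = sym (trans (+-congʳ (*-identityʳ q)) (-‿inverseʳ q))
      partial (suc n) = begin
        ∑ n (cTerm 0) + q * (q * u) * A′ * 1#
          ≈⟨ +-cong (trans (partial n) (+-congʳ (*-congˡ (A-step n)))) (*-identityʳ _) ⟩
        q * (1-q^ (suc (n ℕ.* 2)) * A′) - q + q * (q * u) * A′
          ≈⟨ solve 3 (λ q u a → q :* ((con 1ℤ :- q :* u) :* a) :- q :+ q :* (q :* u) :* a := q :* a :- q)
               refl q u A′ ⟩
        q * A′ - q ∎
        where
        u = q ^ (n ℕ.* 2)
        A′ = A (suc n)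

    -- Expanded, this is the sum over m ≤ n of q^{mj} (1+q^{m+1})...(1+q^n), the series D_j with
    -- parts bounded by n. The recursion admits one more part size at a time.
    dSum : ℕ → ℕ → Carrier
    dSum j zero    = ⟪ 1ℤ ⟫
    dSum j (suc n) = dSum j n * 1+q^ (suc n) + (q ^ suc n) ^ j

    -- The boundary term (q^{n+1})^j makes the relation exact for every n: the left side at n+1 is
    -- the left side at n times 1+q^{n+1}. At n = L the term vanishes as soon as j ≥ 1.
    D-partial : ∀ j n → dSum (suc j) n + 1-q^ j * dSum j n + (q ^ suc n) ^ j ≈ ⟪ + 2 ⟫ * distinct n
    D-partial j zero = begin
      ⟪ 1ℤ ⟫ + 1-q^ j * ⟪ 1ℤ ⟫ + (q * 1#) ^ j
        ≈⟨ +-congˡ (^-congˡ j (*-identityʳ q)) ⟩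
      ⟪ 1ℤ ⟫ + 1-q^ j * ⟪ 1ℤ ⟫ + q ^ j
        ≈⟨ solve 1 (λ w → con 1ℤ :+ (con 1ℤ :- w) :* con 1ℤ :+ w := con (+ 2) :* con 1ℤ) refl (q ^ j) ⟩
      ⟪ + 2 ⟫ * ⟪ 1ℤ ⟫
        ≈⟨ *-congˡ 1-homo ⟩
      ⟪ + 2 ⟫ * 1# ∎
    D-partial j (suc n) = begin
      D₁ * 1+q^ (suc n) + w * w ^ j + 1-q^ j * (D₀ * 1+q^ (suc n) + w ^ j) + (q * w) ^ j
        ≈⟨ +-congˡ (^-distrib-* q w j) ⟩
      D₁ * 1+q^ (suc n) + w * w ^ j + 1-q^ j * (D₀ * 1+q^ (suc n) + w ^ j) + q ^ j * w ^ j
        ≈⟨ solve 5 (λ a b w x y → a :* (con 1ℤ :+ w) :+ w :* x :+ (con 1ℤ :- y) :* (b :* (con 1ℤ :+ w) :+ x) :+ y :* x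
                    := (a :+ (con 1ℤ :- y) :* b :+ x) :* (con 1ℤ :+ w)) refl D₁ D₀ w (w ^ j) (q ^ j) ⟩
      (D₁ + 1-q^ j * D₀ + w ^ j) * 1+q^ (suc n)
        ≈⟨ *-congʳ (D-partial j n) ⟩
      ⟪ + 2 ⟫ * distinct n * 1+q^ (suc n)
        ≈⟨ *-assoc _ _ _ ⟩
      ⟪ + 2 ⟫ * distinct (suc n) ∎
      where
      D₁ = dSum (suc j) n
      D₀ = dSum j n
      w = q ^ suc n

    D-suc : ∀ j → dSum (2 ℕ.+ j) L ≈ ⟪ + 2 ⟫ * P - 1-q^ (suc j) * dSum (suc j) L
    D-suc j = begin
      d ≈⟨ solve 3 (λ d e x → d := d :+ e :+ x :- e :- x) refl d e x ⟩
      d + e + x - e - x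
        ≈⟨ +-cong (+-congʳ (D-partial (suc j) L)) (-‿cong (trans (*-congʳ truncation) (trans (zeroˡ _) (sym 0-homo)))) ⟩
      ⟪ + 2 ⟫ * P - e - ⟪ 0ℤ ⟫
        ≈⟨ solve 1 (λ x → x :- con 0ℤ := x) refl (⟪ + 2 ⟫ * P - e) ⟩
      ⟪ + 2 ⟫ * P - e ∎
      where
      d = dSum (2 ℕ.+ j) L
      e = 1-q^ (suc j) * dSum (suc j) L
      x = (q ^ suc L) ^ suc j

    -- For j = 0 the factor 1-q^0 removes D_0, and the boundary term is 1 instead of 0. This 1 is
    -- the origin of the nonzero initial defect 1+q.
    D-one : dSum 1 L ≈ ⟪ + 2 ⟫ * P - ⟪ 1ℤ ⟫
    D-one = begin
      d ≈⟨ solve 2 (λ d e → d := d :+ (con 1ℤ :- con 1ℤ) :* e :+ con 1ℤ :- con 1ℤ) refl d (dSum 0 L) ⟩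
      d + (⟪ 1ℤ ⟫ - ⟪ 1ℤ ⟫) * dSum 0 L + ⟪ 1ℤ ⟫ - ⟪ 1ℤ ⟫
        ≈⟨ +-congʳ (+-cong (+-congˡ (*-congʳ (+-congˡ (-‿cong 1-homo)))) 1-homo) ⟩
      d + 1-q^ 0 * dSum 0 L + 1# - ⟪ 1ℤ ⟫
        ≈⟨ +-congʳ (D-partial 0 L) ⟩
      ⟪ + 2 ⟫ * P - ⟪ 1ℤ ⟫ ∎
      where d = dSum 1 L

    -- defect κ is R_{κ+1}.
    defect : ℕ → Carrier
    defect zero    = ⟪ 1ℤ ⟫ + q
    defect (suc κ) = 1-q^ (2 ℕ.+ κ ℕ.* 2) * (1-q^ (3 ℕ.+ κ ℕ.* 2) * defect κ)
                   + ⟪ + 2 ⟫ * (q ^ (3 ℕ.+ κ ℕ.* 2) * evens (suc κ) 0)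

    D≈2C+defect : ∀ κ → dSum (2 ℕ.+ κ ℕ.* 2) L ≈ ⟪ + 2 ⟫ * cSum κ + defect κ
    D≈2C+defect zero = begin
      dSum 2 L
        ≈⟨ D-suc 0 ⟩
      ⟪ + 2 ⟫ * P - 1-q^ 1 * dSum 1 L
        ≈⟨ +-congˡ (-‿cong (*-cong (+-congˡ (-‿cong (*-identityʳ q))) D-one)) ⟩
      ⟪ + 2 ⟫ * P - (⟪ 1ℤ ⟫ - q) * (⟪ + 2 ⟫ * P - ⟪ 1ℤ ⟫)
        ≈⟨ solve 2 (λ q p → con (+ 2) :* p :- (con 1ℤ :- q) :* (con (+ 2) :* p :- con 1ℤ)
                         := con (+ 2) :* (q :* p :- q) :+ (con 1ℤ :+ q)) refl q P ⟩
      ⟪ + 2 ⟫ * (q * P - q) + defect 0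
        ≈⟨ +-congʳ (*-congˡ C-zero) ⟨
      ⟪ + 2 ⟫ * cSum 0 + defect 0 ∎
    D≈2C+defect (suc κ) = begin
      dSum (4 ℕ.+ κ ℕ.* 2) L
        ≈⟨ trans (D-suc (2 ℕ.+ κ ℕ.* 2))
             (+-congˡ (-‿cong (*-congˡ (trans (D-suc (1 ℕ.+ κ ℕ.* 2)) (+-congˡ (-‿cong (*-congˡ (D≈2C+defect κ)))))))) ⟩
      ⟪ + 2 ⟫ * P - 1-q^ (3 ℕ.+ κ ℕ.* 2) * (⟪ + 2 ⟫ * P - 1-q^ (2 ℕ.+ κ ℕ.* 2) * (⟪ + 2 ⟫ * cSum κ + defect κ))
        ≈⟨ solve 6 (λ w a p c r e →
             con (+ 2) :* p :- (con 1ℤ :- w) :* (con (+ 2) :* p :- a :* (con (+ 2) :* c :+ r))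
             := con (+ 2) :* (a :* ((con 1ℤ :- w) :* c) :+ w :* p :- w :* e)
                :+ (a :* ((con 1ℤ :- w) :* r) :+ con (+ 2) :* (w :* e)))
             refl (q ^ (3 ℕ.+ κ ℕ.* 2)) (1-q^ (2 ℕ.+ κ ℕ.* 2)) P (cSum κ) (defect κ) (evens (suc κ) 0) ⟩
      _ ≈⟨ +-congʳ (*-congˡ (C-step κ)) ⟨
      ⟪ + 2 ⟫ * cSum (suc κ) + defect (suc κ) ∎

open import Defs
open import Data.Bool using (if_then_else_)
open import Data.Empty using (⊥)
open import Data.Integer using (_-_)
import Data.Integer.Tactic.RingSolver as ℤ
open import Data.List using (List; []; _∷_; _++_; length; filter; map; upTo; replicate)
open import Data.List.Membership.Propositional using (_∈_; _∉_)
open import Data.List.Membership.Propositional.Properties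
  using (∈-∃++; ∈-++⁺ˡ; ∈-++⁺ʳ; ∈-++⁻; ∈-map⁺; ∈-map⁻; ∈-filter⁺; ∈-filter⁻; ∈-upTo⁺)
open import Data.List.Properties using (length-++; length-map; length-upTo; filter-accept; filter-reject; filter-none)
open import Data.List.Relation.Binary.Permutation.Propositional.Properties using (↭-length; shift)
open import Data.List.Relation.Unary.All as All using (All; []; _∷_)
open import Data.List.Relation.Unary.AllPairs using ([]; _∷_)
open import Data.List.Relation.Unary.Any using (here; there)
open import Data.List.Relation.Unary.Linked as Linked using (Linked; []; [-]; _∷_)
import Data.List.Relation.Unary.Linked.Properties as Linked
open import Data.List.Relation.Unary.Unique.Propositional using (Unique)
import Data.List.Relation.Unary.Unique.Propositional.Properties as Unique
open import Data.Nat using (_+_; _*_; _∸_; _≥_; _≟_; _≤?_; _<?_; parity)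
open import Data.Nat.Divisibility using (_∣?_; ∣m+n∣m⇒∣n; ∣m∣n⇒∣m+n; ∣-refl; >⇒∤; _∣0)
open import Data.Nat.Induction using (<-rec)
open import Data.Nat.ListAction using (sum)
open import Data.Nat.Properties
import Data.Nat.Tactic.RingSolver as ℕ
open import Data.Parity using (Parity; 0ℙ; 1ℙ; _⁻¹)
import Data.Parity.Properties as ℙ
open import Data.Product using (∃; ∃₂; _×_; _,_; proj₁; proj₂)
open import Data.Rational using (_/_)
open import Data.Rational.Properties using (fromℚᵘ-cong)
open import Data.Rational.Unnormalised using (mkℚᵘ; *≡*)
open import Data.Sum using (_⊎_; inj₁; inj₂)
open import Function.Bundles using (mk⇔)
open import Relation.Binary.Definitions using (tri<; tri≈; tri>)
open import Relation.Binary.PropositionalEquality using (_≢_; refl; sym; trans; cong; cong₂; subst; module ≡-Reasoning)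
open import Relation.Nullary.Decidable using (dec-true; dec-false; does-⇔)
open import Relation.Unary using (Pred; Decidable)

-- Integer power series and their Cauchy product.

Series : Set
Series = ℕ → ℤ

infixl 6 _⊕_
infixl 7 _⊛_ _·_

_⊕_ : Series → Series → Series
(f ⊕ g) n = f n ℤ.+ g n

⊖_ : Series → Series
(⊖ f) n = ℤ.- f n

_·_ : ℤ → Series → Series
(a · f) n = a ℤ.* f n

-- Splitting f as f(0) + q (f ∘ suc) gives the Cauchy product without a sum over indices, so the
-- ring laws follow by induction on the coefficient.
_⊛_ : Series → Series → Series
(f ⊛ g) zero    = f 0 ℤ.* g 0
(f ⊛ g) (suc n) = f 0 ℤ.* g (suc n) ℤ.+ (f ∘ suc ⊛ g) n

const : ℤ → Series
const a zero    = a
const a (suc n) = 0ℤ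

-- Coefficient n of a product depends only on coefficients up to n. With the hypotheses restricted
-- in this way, truncated equality is a congruence.
⊛-cong : ∀ {f f′ g g′} n → (∀ m → m ≤ n → f m ≡ f′ m) → (∀ m → m ≤ n → g m ≡ g′ m) →
         (f ⊛ g) n ≡ (f′ ⊛ g′) n
⊛-cong zero    p r = cong₂ ℤ._*_ (p 0 z≤n) (r 0 z≤n)
⊛-cong (suc n) p r = cong₂ ℤ._+_ (cong₂ ℤ._*_ (p 0 z≤n) (r (suc n) ≤-refl))
  (⊛-cong n (λ m → p (suc m) ∘ s≤s) (λ m m≤n → r m (m≤n⇒m≤1+n m≤n)))

⊛-zeroˡ : ∀ {f} g n → (∀ m → f m ≡ 0ℤ) → (f ⊛ g) n ≡ 0ℤ
⊛-zeroˡ {f} g zero    f≡0 rewrite f≡0 0 = refl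
⊛-zeroˡ {f} g (suc n) f≡0 rewrite f≡0 0 = trans (ℤ.+-identityˡ _) (⊛-zeroˡ g n (f≡0 ∘ suc))

const-⊛ : ∀ a f n → (const a ⊛ f) n ≡ a ℤ.* f n
const-⊛ a f zero    = refl
const-⊛ a f (suc n) = trans (cong (λ z → a ℤ.* f (suc n) ℤ.+ z) (⊛-zeroˡ f n λ _ → refl)) (ℤ.+-identityʳ (a ℤ.* f (suc n)))

⊛-distribʳ : ∀ f g h n → ((g ⊕ h) ⊛ f) n ≡ (g ⊛ f) n ℤ.+ (h ⊛ f) n
⊛-distribʳ f g h zero    = ℤ.*-distribʳ-+ (f 0) (g 0) (h 0)
⊛-distribʳ f g h (suc n) rewrite ⊛-distribʳ f (g ∘ suc) (h ∘ suc) n =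
  lemma (g 0) (h 0) (f (suc n)) ((g ∘ suc ⊛ f) n) ((h ∘ suc ⊛ f) n)
  where
  lemma : ∀ a b x u v → (a ℤ.+ b) ℤ.* x ℤ.+ (u ℤ.+ v) ≡ (a ℤ.* x ℤ.+ u) ℤ.+ (b ℤ.* x ℤ.+ v)
  lemma = ℤ.solve-∀

·-⊛ : ∀ a f g n → ((a · f) ⊛ g) n ≡ a ℤ.* (f ⊛ g) n
·-⊛ a f g zero    = ℤ.*-assoc a (f 0) (g 0)
·-⊛ a f g (suc n) rewrite ·-⊛ a (f ∘ suc) g n = lemma a (f 0) (g (suc n)) ((f ∘ suc ⊛ g) n)
  where
  lemma : ∀ a x y z → a ℤ.* x ℤ.* y ℤ.+ a ℤ.* z ≡ a ℤ.* (x ℤ.* y ℤ.+ z)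
  lemma = ℤ.solve-∀

-- The defining recursion peels the left factor; commutativity needs this mirror image, which peels
-- the right one.
⊛-sucʳ : ∀ f g n → (f ⊛ g) (suc n) ≡ f (suc n) ℤ.* g 0 ℤ.+ (f ⊛ g ∘ suc) n
⊛-sucʳ f g zero    = ℤ.+-comm (f 0 ℤ.* g 1) _
⊛-sucʳ f g (suc n) rewrite ⊛-sucʳ (f ∘ suc) g n =
  lemma (f 0 ℤ.* g (suc (suc n))) (f (suc (suc n)) ℤ.* g 0) ((f ∘ suc ⊛ g ∘ suc) n)
  where
  lemma : ∀ x y z → x ℤ.+ (y ℤ.+ z) ≡ y ℤ.+ (x ℤ.+ z)
  lemma = ℤ.solve-∀

⊛-comm : ∀ f g n → (f ⊛ g) n ≡ (g ⊛ f) n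
⊛-comm f g zero    = ℤ.*-comm (f 0) (g 0)
⊛-comm f g (suc n) = trans (cong₂ ℤ._+_ (ℤ.*-comm (f 0) _) (⊛-comm (f ∘ suc) g n)) (sym (⊛-sucʳ g f n))

⊛-assoc : ∀ f g h n → ((f ⊛ g) ⊛ h) n ≡ (f ⊛ (g ⊛ h)) n
⊛-assoc f g h zero    = ℤ.*-assoc (f 0) (g 0) (h 0)
⊛-assoc f g h (suc n) = trans (cong (λ z → f 0 ℤ.* g 0 ℤ.* h (suc n) ℤ.+ z) tail)
  (lemma (f 0) (g 0) (h (suc n)) ((g ∘ suc ⊛ h) n) ((f ∘ suc ⊛ (g ⊛ h)) n))
  where
  tail : (((f 0 · g ∘ suc) ⊕ (f ∘ suc ⊛ g)) ⊛ h) n ≡ f 0 ℤ.* (g ∘ suc ⊛ h) n ℤ.+ (f ∘ suc ⊛ (g ⊛ h)) n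
  tail = trans (⊛-distribʳ h (f 0 · g ∘ suc) (f ∘ suc ⊛ g) n)
               (cong₂ ℤ._+_ (·-⊛ (f 0) (g ∘ suc) h n) (⊛-assoc (f ∘ suc) g h n))
  lemma : ∀ a b c u v → a ℤ.* b ℤ.* c ℤ.+ (a ℤ.* u ℤ.+ v) ≡ a ℤ.* (b ℤ.* c ℤ.+ u) ℤ.+ v
  lemma = ℤ.solve-∀

q : Series
q 0       = 0ℤ
q 1       = 1ℤ
q (suc (suc n)) = 0ℤ

q-⊛-suc : ∀ f n → (q ⊛ f) (suc n) ≡ f n
q-⊛-suc f n = trans (ℤ.+-identityˡ _) (trans (⊛-cong n (λ { zero _ → refl ; (suc m) _ → refl }) (λ _ _ → refl))
                    (trans (const-⊛ 1ℤ f n) (ℤ.*-identityˡ _)))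

-- The ring of series modulo q^{L+1}.

module Truncated (L : ℕ) where

  infix 4 _≈_
  -- The quotient by q^{L+1} keeps full series as carrier, so facts proved for all coefficients can
  -- be used in it directly.
  _≈_ : Series → Series → Set
  f ≈ g = ∀ n → n ≤ L → f n ≡ g n

  ring : CommutativeRing 0ℓ 0ℓ
  ring = record
    { Carrier = Series
    ; _≈_ = _≈_
    ; _+_ = _⊕_
    ; _*_ = _⊛_
    ; -_  = ⊖_
    ; 0#  = const 0ℤ
    ; 1#  = const 1ℤ
    ; isCommutativeRing = record
      { isRing = record
        { +-isAbelianGroup = record
          { isGroup = record
            { isMonoid = record
              { isSemigroup = record
                { isMagma = record
                  { isEquivalence = record
                    { refl  = λ _ _ → refl
                    ; sym   = λ p n n≤L → sym (p n n≤L)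
                    ; trans = λ p r n n≤L → trans (p n n≤L) (r n n≤L)
                    }
                  ; ∙-cong = λ p r n n≤L → cong₂ ℤ._+_ (p n n≤L) (r n n≤L)
                  }
                ; assoc = λ f g h n _ → ℤ.+-assoc (f n) (g n) (h n)
                }
              ; identity = (λ f n _ → trans (cong (ℤ._+ f n) (const0 n)) (ℤ.+-identityˡ (f n)))
                         , (λ f n _ → trans (cong (λ z → f n ℤ.+ z) (const0 n)) (ℤ.+-identityʳ (f n)))
              }
            ; inverse = (λ f n _ → trans (ℤ.+-inverseˡ (f n)) (sym (const0 n)))
                      , (λ f n _ → trans (ℤ.+-inverseʳ (f n)) (sym (const0 n)))
            ; ⁻¹-cong = λ p n n≤L → cong ℤ.-_ (p n n≤L)
            }
          ; comm = λ f g n _ → ℤ.+-comm (f n) (g n)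
          }
        ; *-cong = λ p r n n≤L → ⊛-cong n (λ m m≤n → p m (≤-trans m≤n n≤L)) (λ m m≤n → r m (≤-trans m≤n n≤L))
        ; *-assoc = λ f g h n _ → ⊛-assoc f g h n
        ; *-identity = (λ f n _ → identity f n)
                     , (λ f n _ → trans (⊛-comm f (const 1ℤ) n) (identity f n))
        ; distrib = (λ f g h n _ → trans (⊛-comm f (g ⊕ h) n)
                      (trans (⊛-distribʳ f g h n) (cong₂ ℤ._+_ (⊛-comm g f n) (⊛-comm h f n))))
                  , (λ f g h n _ → ⊛-distribʳ f g h n)
        }
      ; *-comm = λ f g n _ → ⊛-comm f g n
      }
    }
    where
    const0 : ∀ n → const 0ℤ n ≡ 0ℤ
    const0 zero    = refl
    const0 (suc n) = refl
    identity : ∀ f n → (const 1ℤ ⊛ f) n ≡ f n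
    identity f n = trans (const-⊛ 1ℤ f n) (ℤ.*-identityˡ (f n))

  constants : CommutativeRing.rawRing ℤ.+-*-commutativeRing -Raw-AlmostCommutative⟶ fromCommutativeRing ring
  constants = record
    { ⟦_⟧    = const
    ; +-homo = λ { a b zero _ → refl ; a b (suc n) _ → refl }
    ; *-homo = λ { a b zero _ → refl ; a b (suc n) _ → sym (trans (const-⊛ a (const b) (suc n)) (ℤ.*-zeroʳ a)) }
    ; -‿homo = λ { a zero _ → refl ; a (suc n) _ → refl }
    ; 0-homo = λ _ _ → refl
    ; 1-homo = λ _ _ → refl
    }

-- Enumerations and signed counts.

length-⊆ : ∀ {A : Set} {xs ys : List A} → Unique xs → (∀ {x} → x ∈ xs → x ∈ ys) → length xs ≤ length ys
length-⊆ {xs = []} _ _ = z≤n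
length-⊆ {xs = x ∷ xs} (x∉ ∷ u) sub with ∈-∃++ (sub (here refl))
... | as , bs , refl = ≤-trans (s≤s (length-⊆ u sub′)) (≤-reflexive (sym (↭-length (shift x as bs))))
  where
  sub′ : ∀ {y} → y ∈ xs → y ∈ as ++ bs
  sub′ {y} y∈ with ∈-++⁻ as (sub (there y∈))
  ... | inj₁ y∈as         = ∈-++⁺ˡ y∈as
  ... | inj₂ (here refl)  = contradiction refl (All.lookup x∉ y∈)
  ... | inj₂ (there y∈bs) = ∈-++⁺ʳ as y∈bs

open Enumeration

#-cong : ∀ {A : Set} {P Q : Pred A 0ℓ} (e : Enumeration P) (f : Enumeration Q) →
         (∀ {x} → P x → Q x) → (∀ {x} → Q x → P x) → # e ≡ # f
#-cong e f to from = ≤-antisym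
  (length-⊆ (unique e) (complete f ∘ to ∘ sound e))
  (length-⊆ (unique f) (complete e ∘ from ∘ sound f))

none : ∀ {A : Set} {P : Pred A 0ℓ} → (∀ {x} → ¬ P x) → Enumeration P
none ¬P = record { elements = [] ; unique = [] ; sound = λ () ; complete = λ p → contradiction p ¬P }

image : ∀ {A B : Set} {P : Pred A 0ℓ} {Q : Pred B 0ℓ} (f : A → B) → (∀ {x y} → f x ≡ f y → x ≡ y) →
        (∀ {x} → P x → Q (f x)) → (∀ {y} → Q y → ∃ λ x → y ≡ f x × P x) → Enumeration P → Enumeration Q
image {Q = Q} f f-inj to from e = record
  { elements = map f (elements e)
  ; unique   = Unique.map⁺ f-inj (unique e)
  ; sound    = λ y∈ → case ∈-map⁻ f y∈ of λ { (_ , x∈ , refl) → to (sound e x∈) }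
  ; complete = λ q → case from q of λ { (_ , refl , p) → ∈-map⁺ f (complete e p) }
  }

union : ∀ {A : Set} {P Q R : Pred A 0ℓ} → (∀ {x} → P x → ¬ Q x) → (∀ {x} → P x → R x) → (∀ {x} → Q x → R x) →
        (∀ {x} → R x → P x ⊎ Q x) → Enumeration P → Enumeration Q → Enumeration R
union disjoint p⇒r q⇒r r⇒ e f = record
  { elements = elements e ++ elements f
  ; unique   = Unique.++⁺ (unique e) (unique f) λ (x∈e , x∈f) → disjoint (sound e x∈e) (sound f x∈f)
  ; sound    = λ x∈ → case ∈-++⁻ (elements e) x∈ of λ { (inj₁ x∈e) → p⇒r (sound e x∈e) ; (inj₂ x∈f) → q⇒r (sound f x∈f) }
  ; complete = λ r → case r⇒ r of λ { (inj₁ p) → ∈-++⁺ˡ (complete e p) ; (inj₂ q) → ∈-++⁺ʳ (elements e) (complete f q) }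
  }

-- The integer z is the number of solutions of even class minus that of odd class. Keeping both
-- enumerations lets disjoint unions, injections and sign changes act on z as addition, identity and
-- negation.
record SignedCount {A : Set} (P : Parity → Pred A 0ℓ) (z : ℤ) : Set where
  constructor signed
  field
    even       : Enumeration (P 0ℙ)
    odd        : Enumeration (P 1ℙ)
    difference : + # even ℤ.- + # odd ≡ z

-- This yields every identity between a count and a coefficient: one count comes from the
-- definition, the other from a product formula for an equivalent predicate.
signed-unique : ∀ {A : Set} {P Q : Parity → Pred A 0ℓ} {y z} →
                (∀ {π x} → P π x → Q π x) → (∀ {π x} → Q π x → P π x) →
                SignedCount P y → SignedCount Q z → y ≡ z
signed-unique to from (signed e o refl) (signed e′ o′ refl) =
  cong₂ (λ a b → + a ℤ.- + b) (#-cong e e′ to from) (#-cong o o′ to from)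

signed-none : ∀ {A : Set} {P : Parity → Pred A 0ℓ} → (∀ {π x} → ¬ P π x) → SignedCount P 0ℤ
signed-none ¬P = signed (none ¬P) (none ¬P) refl

signed-image : ∀ {A B : Set} {P : Parity → Pred A 0ℓ} {Q : Parity → Pred B 0ℓ} {y} (f : A → B) →
               (∀ {x y} → f x ≡ f y → x ≡ y) → (∀ {π x} → P π x → Q π (f x)) →
               (∀ {π y} → Q π y → ∃ λ x → y ≡ f x × P π x) → SignedCount P y → SignedCount Q y
signed-image f f-inj to from (signed e o d) =
  signed (image f f-inj to from e) (image f f-inj to from o)
    (trans (cong₂ (λ a b → + a ℤ.- + b) (length-map f (elements e)) (length-map f (elements o))) d)

signed-cast : ∀ {A : Set} {P Q : Parity → Pred A 0ℓ} {y z} →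
              (∀ {π x} → P π x → Q π x) → (∀ {π x} → Q π x → P π x) → y ≡ z →
              SignedCount P y → SignedCount Q z
signed-cast {Q = Q} to from eq c = subst (SignedCount Q) eq (signed-image id id to (λ q → _ , refl , from q) c)

signed-flip : ∀ {A : Set} {P : Parity → Pred A 0ℓ} {y} → SignedCount P y → SignedCount (P ∘ _⁻¹) (ℤ.- y)
signed-flip (signed e o refl) = signed o e (lemma (+ # o) (+ # e))
  where
  lemma : ∀ a b → a ℤ.- b ≡ ℤ.- (b ℤ.- a)
  lemma = ℤ.solve-∀

signed-union : ∀ {A : Set} {P Q R : Parity → Pred A 0ℓ} {y z} → (∀ {π x} → P π x → ¬ Q π x) →
               (∀ {π x} → P π x → R π x) → (∀ {π x} → Q π x → R π x) → (∀ {π x} → R π x → P π x ⊎ Q π x) →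
               SignedCount P y → SignedCount Q z → SignedCount R (y ℤ.+ z)
signed-union disjoint p⇒r q⇒r r⇒ (signed e o refl) (signed e′ o′ refl) =
  signed (union disjoint p⇒r q⇒r r⇒ e e′) (union disjoint p⇒r q⇒r r⇒ o o′)
    (trans (cong₂ (λ a b → + a ℤ.- + b) (length-++ (elements e)) (length-++ (elements o)))
      (trans (cong₂ ℤ._-_ (ℤ.pos-+ (# e) (# e′)) (ℤ.pos-+ (# o) (# o′)))
        (lemma (+ # e) (+ # e′) (+ # o) (+ # o′))))
  where
  lemma : ∀ a b c d → (a ℤ.+ b) ℤ.- (c ℤ.+ d) ≡ (a ℤ.- c) ℤ.+ (b ℤ.- d)
  lemma = ℤ.solve-∀

-- Multiplicities of parts.

count : ℕ → List ℕ → ℕ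
count p xs = length (filter (_≟ p) xs)

count-here : ∀ p xs → count p (p ∷ xs) ≡ suc (count p xs)
count-here p xs = cong length (filter-accept (_≟ p) refl)

count-there : ∀ {p} x xs → x ≢ p → count p (x ∷ xs) ≡ count p xs
count-there {p} x xs x≢p = cong length (filter-reject (_≟ p) x≢p)

∉⇒count≡0 : ∀ {p} xs → p ∉ xs → count p xs ≡ 0
∉⇒count≡0 {p} xs p∉ = cong length (filter-none (_≟ p) {xs = xs} (All.tabulate λ { x∈ refl → p∉ x∈ }))

∈⇒count≥1 : ∀ {p} xs → p ∈ xs → 1 ≤ count p xs
∈⇒count≥1 {p} (x ∷ xs) (here refl) = ≤-trans (s≤s z≤n) (≤-reflexive (sym (count-here p xs)))
∈⇒count≥1 {p} (x ∷ xs) (there p∈) with x ≟ p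
... | yes refl = ≤-trans (s≤s z≤n) (≤-reflexive (sym (count-here p xs)))
... | no x≢p   = ≤-trans (∈⇒count≥1 xs p∈) (≤-reflexive (sym (count-there x xs x≢p)))

count≥1⇒∈ : ∀ {p} xs → 1 ≤ count p xs → p ∈ xs
count≥1⇒∈ {p} xs c with filter (_≟ p) xs in eq
... | y ∷ _ with ∈-filter⁻ (_≟ p) {xs = xs} (subst (y ∈_) (sym eq) (here refl))
...   | y∈ , refl = y∈

module _ {Q : Pred ℕ 0ℓ} (Q? : Decidable Q) where

  unique⇒count≤1 : ∀ {p} xs → Unique (filter Q? xs) → Q p → count p xs ≤ 1
  unique⇒count≤1 {p} [] u qp = z≤n
  unique⇒count≤1 {p} (x ∷ xs) u qp with x ≟ p
  ... | no x≢p = subst (_≤ 1) (sym (count-there x xs x≢p)) (unique⇒count≤1 xs (tail u) qp)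
    where
    tail : Unique (filter Q? (x ∷ xs)) → Unique (filter Q? xs)
    tail u with Q? x
    tail (_ ∷ u) | yes _ = u
    tail u       | no _  = u
  ... | yes refl rewrite filter-accept Q? {xs = xs} qp with u
  ...   | x∉ ∷ _ = subst (_≤ 1) (sym (trans (count-here p xs)
            (cong suc (∉⇒count≡0 xs λ p∈ → All.lookup x∉ (∈-filter⁺ Q? p∈ qp) refl)))) ≤-refl

  count≤1⇒unique : ∀ xs → (∀ p → Q p → count p xs ≤ 1) → Unique (filter Q? xs)
  count≤1⇒unique [] c = []
  count≤1⇒unique (x ∷ xs) c with Q? x
  ... | no ¬qx = count≤1⇒unique xs λ p qp →
          subst (_≤ 1) (count-there x xs λ { refl → ¬qx qp }) (c p qp)
  ... | yes qx = All.tabulate fresh ∷ count≤1⇒unique xs rest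
    where
    x∉xs : x ∉ xs
    x∉xs x∈ = <-irrefl refl (≤-trans (s≤s (∈⇒count≥1 xs x∈)) (≤-trans (≤-reflexive (sym (count-here x xs))) (c x qx)))
    fresh : ∀ {y} → y ∈ filter Q? xs → x ≢ y
    fresh y∈ refl = x∉xs (proj₁ (∈-filter⁻ Q? {xs = xs} y∈))
    rest : ∀ p → Q p → count p xs ≤ 1
    rest p qp with x ≟ p
    ... | yes refl = ≤-trans (≤-reflexive (∉⇒count≡0 xs x∉xs)) z≤n
    ... | no x≢p   = subst (_≤ 1) (count-there x xs x≢p) (c p qp)

-- The three kinds of condition on the multiplicity of one part size that occur in B, C and D, with
-- generating functions x^j, x^j/(1-x) and 1+x.
data Mode : Set where
  exactly atLeast : ℕ → Mode
  once            : Mode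

Ok : Mode → ℕ → Set
Ok (exactly j) c = c ≡ j
Ok (atLeast j) c = j ≤ c
Ok once        c = c ≤ 1

beyond : ∀ {N p} λs → All (_≤ N) λs → N < p → count p λs ≡ 0
beyond λs ≤N N<p = ∉⇒count≡0 λs λ p∈ → <⇒≱ N<p (All.lookup ≤N p∈)

smallest-unique : ∀ {m m′ λs} → Smallest m λs → Smallest m′ λs → m ≡ m′
smallest-unique (m∈ , m≤) (m′∈ , m′≤) = ≤-antisym (All.lookup m≤ m′∈) (All.lookup m′≤ m∈)

largest-unique : ∀ {m m′ λs} → Largest m λs → Largest m′ λs → m ≡ m′
largest-unique (m∈ , ≤m) (m′∈ , ≤m′) = ≤-antisym (All.lookup ≤m′ m∈) (All.lookup ≤m m′∈)

-- Multiplicity conditions for D.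

modeD : ℕ → ℕ → ℕ → Mode
modeD j m p with <-cmp p m
... | tri< _ _ _ = exactly 0
... | tri≈ _ _ _ = exactly j
... | tri> _ _ _ = once

module _ {j m p : ℕ} where

  modeD-< : p < m → modeD j m p ≡ exactly 0
  modeD-< p<m with <-cmp p m
  ... | tri< _ _ _   = refl
  ... | tri≈ p≮m _ _ = contradiction p<m p≮m
  ... | tri> p≮m _ _ = contradiction p<m p≮m

  modeD-≡ : p ≡ m → modeD j m p ≡ exactly j
  modeD-≡ p≡m with <-cmp p m
  ... | tri< _ p≢m _ = contradiction p≡m p≢m
  ... | tri≈ _ _ _   = refl
  ... | tri> _ p≢m _ = contradiction p≡m p≢m

  modeD-> : m < p → modeD j m p ≡ once
  modeD-> m<p with <-cmp p m
  ... | tri< _ _ p≯m = contradiction m<p p≯m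
  ... | tri≈ _ _ p≯m = contradiction m<p p≯m
  ... | tri> _ _ _   = refl

zeros : ℕ → ℕ → ℕ
zeros j zero    = j
zeros j (suc m) = 0

modeD-zero : ∀ j m → modeD j m 0 ≡ exactly (zeros j m)
modeD-zero j zero    = modeD-≡ {j} {0} refl
modeD-zero j (suc m) = modeD-< {j} {suc m} (s≤s z≤n)

-- The sign predicate for D, in which no part carries a sign; D then fits the signed machinery of B
-- and C.
never? : Decidable {A = ℕ} (λ _ → ⊥)
never? _ = no id

-- Parity, the range of exceptional parts, and multiplicity conditions for B and C.

even-double : ∀ t → Even (t * 2)
even-double zero    = refl
even-double (suc t) = even-double t

even-half : ∀ d → Even d → ∃ λ t → d ≡ t * 2
even-half zero          _ = 0 , refl
even-half (suc (suc d)) e with even-half d e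
... | t , refl = suc t , refl

odd-double : ∀ t → Odd (suc (t * 2))
odd-double zero    = refl
odd-double (suc t) = odd-double t

¬even⇒odd : ∀ p → ¬ Even p → Odd p
¬even⇒odd p ¬e with parity p
... | 0ℙ = contradiction refl ¬e
... | 1ℙ = refl

odd⇒¬even : ∀ p → Odd p → ¬ Even p
odd⇒¬even p o e = case trans (sym o) e of λ ()

-- With ℓ = l+1 and k = κ+1 this is 2ℓ+2k-2, the end of the range of exceptional parts.
top : ℕ → ℕ → ℕ
top κ l = (κ + suc l) * 2

range-top : ∀ κ l → 2 * suc l + 2 * suc κ ∸ 2 ≡ top κ l
range-top κ l = trans (cong₂ (λ a b → a + b ∸ 2) (*-comm 2 (suc l)) (*-comm 2 (suc κ))) (lemma l κ)
  where
  lemma : ∀ l κ → l * 2 + (2 + κ * 2) ≡ (κ + suc l) * 2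
  lemma = ℕ.solve-∀

range-bottom : ∀ l → 2 * suc l + 2 ≡ suc (suc l) * 2
range-bottom l = trans (cong (_+ 2) (*-comm 2 (suc l))) (+-comm (suc l * 2) 2)

2ℓ≤top : ∀ κ l → 2 * suc l ≤ top κ l
2ℓ≤top κ l = ≤-trans (≤-reflexive (*-comm 2 (suc l))) (*-monoˡ-≤ 2 (m≤n+m (suc l) κ))

2ℓ∸1-odd : ∀ l → Odd (2 * suc l ∸ 1)
2ℓ∸1-odd l = subst (λ m → Odd (m ∸ 1)) (*-comm (suc l) 2) (odd-double l)

-- By pigeonhole: the range contains just the κ even numbers 2(l+2+t) with t < κ. This recovers the
-- length clause of `Exceptional` from conditions on single multiplicities.
exceptional-length : ∀ κ l xs → Unique xs → All Even xs →
  All (λ p → 2 * suc l + 2 ≤ p × p ≤ 2 * suc l + 2 * suc κ ∸ 2) xs → length xs ≤ κ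
exceptional-length κ l xs no-repeat evens range =
  ≤-trans (length-⊆ no-repeat member) (≤-reflexive (trans (length-map part (upTo κ)) (length-upTo κ)))
  where
  part : ℕ → ℕ
  part t = (suc (suc l) + t) * 2
  member : ∀ {p} → p ∈ xs → p ∈ map part (upTo κ)
  member {p} p∈ with even-half p (All.lookup evens p∈) | All.lookup range p∈
  ... | h , refl | lo , hi with m≤n⇒∃[o]m+o≡n (*-cancelʳ-≤ (suc (suc l)) h 2 (≤-trans (≤-reflexive (sym (range-bottom l))) lo))
  ...   | t , refl = ∈-map⁺ part (∈-upTo⁺ t<κ)
    where
    t<κ : t < κ
    t<κ = +-cancelˡ-≤ (suc l) (suc t) κ (≤-trans (≤-reflexive (+-suc (suc l) t))
      (≤-trans (*-cancelʳ-≤ (suc (suc l) + t) (κ + suc l) 2 (≤-trans hi (≤-reflexive (range-top κ l))))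
        (≤-reflexive (+-comm κ (suc l)))))

-- In modeB l and modeC l the paper's ℓ is l+1.
modeB : ℕ → ℕ → Mode
modeB l p with even? p | 2 * suc l + 2 ≤? p | <-cmp p (2 * suc l ∸ 1)
... | yes _ | yes _ | _          = once
... | yes _ | no _  | _          = exactly 0
... | no _  | _     | tri< _ _ _ = atLeast 0
... | no _  | _     | tri≈ _ _ _ = atLeast 1
... | no _  | _     | tri> _ _ _ = exactly 0

module _ {l p : ℕ} where

  modeB-even-≥ : Even p → 2 * suc l + 2 ≤ p → modeB l p ≡ once
  modeB-even-≥ e lo with even? p | 2 * suc l + 2 ≤? p | <-cmp p (2 * suc l ∸ 1)
  ... | yes _ | yes _  | _ = refl
  ... | yes _ | no ¬lo | _ = contradiction lo ¬lo
  ... | no ¬e | _      | _ = contradiction e ¬e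

  modeB-even-< : Even p → p < 2 * suc l + 2 → modeB l p ≡ exactly 0
  modeB-even-< e hi with even? p | 2 * suc l + 2 ≤? p | <-cmp p (2 * suc l ∸ 1)
  ... | yes _ | yes lo | _ = contradiction lo (<⇒≱ hi)
  ... | yes _ | no _   | _ = refl
  ... | no ¬e | _      | _ = contradiction e ¬e

  modeB-odd-< : Odd p → p < 2 * suc l ∸ 1 → modeB l p ≡ atLeast 0
  modeB-odd-< o p< with even? p | 2 * suc l + 2 ≤? p | <-cmp p (2 * suc l ∸ 1)
  ... | yes e | _ | _            = contradiction e (odd⇒¬even p o)
  ... | no _  | _ | tri< _ _ _   = refl
  ... | no _  | _ | tri≈ p≮ _ _  = contradiction p< p≮
  ... | no _  | _ | tri> p≮ _ _  = contradiction p< p≮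

  modeB-odd-≡ : Odd p → p ≡ 2 * suc l ∸ 1 → modeB l p ≡ atLeast 1
  modeB-odd-≡ o p≡ with even? p | 2 * suc l + 2 ≤? p | <-cmp p (2 * suc l ∸ 1)
  ... | yes e | _ | _            = contradiction e (odd⇒¬even p o)
  ... | no _  | _ | tri< _ p≢ _  = contradiction p≡ p≢
  ... | no _  | _ | tri≈ _ _ _   = refl
  ... | no _  | _ | tri> _ p≢ _  = contradiction p≡ p≢

  modeB-odd-> : Odd p → 2 * suc l ∸ 1 < p → modeB l p ≡ exactly 0
  modeB-odd-> o p> with even? p | 2 * suc l + 2 ≤? p | <-cmp p (2 * suc l ∸ 1)
  ... | yes e | _ | _            = contradiction e (odd⇒¬even p o)
  ... | no _  | _ | tri< _ _ p≯  = contradiction p> p≯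
  ... | no _  | _ | tri≈ _ _ p≯  = contradiction p> p≯
  ... | no _  | _ | tri> _ _ _   = refl

  modeB-unsigned : ∀ {j} → modeB l p ≡ atLeast j → ¬ Even p
  modeB-unsigned eq e with even? p | 2 * suc l + 2 ≤? p | <-cmp p (2 * suc l ∸ 1)
  modeB-unsigned () e | yes _ | yes _ | _
  modeB-unsigned () e | yes _ | no _  | _
  modeB-unsigned eq e | no ¬e | _     | _ = ¬e e

modeB-zero : ∀ l → modeB l 0 ≡ exactly 0
modeB-zero l = modeB-even-< {l} {0} refl (≤-trans (s≤s z≤n) (m≤n+m 2 (2 * suc l)))

-- The clause at 0 stands apart because 0 ≤ ℓ would otherwise select `once` and admit a zero part.
modeC : ℕ → ℕ → Mode
modeC l zero = exactly 0
modeC l (suc p) with suc p ≤? suc l | <-cmp (suc p) (2 * suc l) | even? (suc p)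
... | yes _ | _          | _     = once
... | no _  | tri< _ _ _ | _     = atLeast 0
... | no _  | tri≈ _ _ _ | _     = atLeast 1
... | no _  | tri> _ _ _ | yes _ = once
... | no _  | tri> _ _ _ | no _  = exactly 0

module _ {l p : ℕ} where

  modeC-≤ℓ : suc p ≤ suc l → modeC l (suc p) ≡ once
  modeC-≤ℓ p≤ℓ with suc p ≤? suc l | <-cmp (suc p) (2 * suc l) | even? (suc p)
  ... | yes _  | _ | _ = refl
  ... | no p≰ℓ | _ | _ = contradiction p≤ℓ p≰ℓ

  modeC-<2ℓ : suc l < suc p → suc p < 2 * suc l → modeC l (suc p) ≡ atLeast 0
  modeC-<2ℓ ℓ<p p<2ℓ with suc p ≤? suc l | <-cmp (suc p) (2 * suc l) | even? (suc p)
  ... | yes p≤ℓ | _            | _ = contradiction p≤ℓ (<⇒≱ ℓ<p)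
  ... | no _    | tri< _ _ _   | _ = refl
  ... | no _    | tri≈ p≮ _ _  | _ = contradiction p<2ℓ p≮
  ... | no _    | tri> p≮ _ _  | _ = contradiction p<2ℓ p≮

  modeC-≡2ℓ : suc l < suc p → suc p ≡ 2 * suc l → modeC l (suc p) ≡ atLeast 1
  modeC-≡2ℓ ℓ<p p≡2ℓ with suc p ≤? suc l | <-cmp (suc p) (2 * suc l) | even? (suc p)
  ... | yes p≤ℓ | _            | _ = contradiction p≤ℓ (<⇒≱ ℓ<p)
  ... | no _    | tri< _ p≢ _  | _ = contradiction p≡2ℓ p≢
  ... | no _    | tri≈ _ _ _   | _ = refl
  ... | no _    | tri> _ p≢ _  | _ = contradiction p≡2ℓ p≢

  private
    ℓ<2ℓ : 2 * suc l < suc p → ¬ (suc p ≤ suc l)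
    ℓ<2ℓ 2ℓ<p p≤ℓ = <⇒≱ 2ℓ<p (≤-trans p≤ℓ (ℓ≤2ℓ (suc l)))

  modeC-even : 2 * suc l < suc p → Even (suc p) → modeC l (suc p) ≡ once
  modeC-even p> e with suc p ≤? suc l | <-cmp (suc p) (2 * suc l) | even? (suc p)
  ... | yes _ | _            | _     = refl
  ... | no _  | tri< _ _ p≯  | _     = contradiction p> p≯
  ... | no _  | tri≈ _ _ p≯  | _     = contradiction p> p≯
  ... | no _  | tri> _ _ _   | yes _ = refl
  ... | no _  | tri> _ _ _   | no ¬e = contradiction e ¬e

  modeC-odd : 2 * suc l < suc p → Odd (suc p) → modeC l (suc p) ≡ exactly 0
  modeC-odd p> o with suc p ≤? suc l | <-cmp (suc p) (2 * suc l) | even? (suc p)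
  ... | yes p≤ℓ | _           | _     = contradiction p≤ℓ (ℓ<2ℓ p>)
  ... | no _  | tri< _ _ p≯  | _     = contradiction p> p≯
  ... | no _  | tri≈ _ _ p≯  | _     = contradiction p> p≯
  ... | no _  | tri> _ _ _   | yes e = contradiction e (odd⇒¬even (suc p) o)
  ... | no _  | tri> _ _ _   | no _  = refl

  modeC-suc-unsigned : ∀ {j} → modeC l (suc p) ≡ atLeast j → ¬ 2 * suc l < suc p
  modeC-suc-unsigned eq p> with suc p ≤? suc l | <-cmp (suc p) (2 * suc l) | even? (suc p)
  modeC-suc-unsigned () p> | yes _ | _ | _
  modeC-suc-unsigned eq p> | no _ | tri< _ _ p≯ | _ = p≯ p>
  modeC-suc-unsigned eq p> | no _ | tri≈ _ _ p≯ | _ = p≯ p>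
  modeC-suc-unsigned () p> | no _ | tri> _ _ _  | yes _
  modeC-suc-unsigned () p> | no _ | tri> _ _ _  | no _

modeC-unsigned : ∀ l p {j} → modeC l p ≡ atLeast j → ¬ 2 * suc l < p
modeC-unsigned l (suc p) = modeC-suc-unsigned {l} {p}

-- Degree bounds.

Degree≤ : ℕ → Series → Set
Degree≤ d f = ∀ n → d < n → f n ≡ 0ℤ

degree-mono : ∀ {c d f} → c ≤ d → Degree≤ c f → Degree≤ d f
degree-mono c≤d p n d<n = p n (≤-<-trans c≤d d<n)

degree-const : ∀ {d} a → Degree≤ d (const a)
degree-const a (suc n) _ = refl

degree-⊕ : ∀ {d f g} → Degree≤ d f → Degree≤ d g → Degree≤ d (f ⊕ g)
degree-⊕ p r n d<n = cong₂ ℤ._+_ (p n d<n) (r n d<n)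

degree-⊖ : ∀ {d f} → Degree≤ d f → Degree≤ d (⊖ f)
degree-⊖ p n d<n = cong ℤ.-_ (p n d<n)

-- Induction on a follows the recursion of the product: dropping the constant term of f lowers its
-- degree bound by one, and for a = 0 leaves the zero series.
degree-⊛ : ∀ a {b f g} → Degree≤ a f → Degree≤ b g → Degree≤ (a + b) (f ⊛ g)
degree-⊛ a {b} {f} {g} p r (suc n) lt
  rewrite r (suc n) (≤-<-trans (m≤n+m b a) lt) | ℤ.*-zeroʳ (f 0) = trans (ℤ.+-identityˡ _) (tail a p lt)
  where
  tail : ∀ a → Degree≤ a f → a + b < suc n → (f ∘ suc ⊛ g) n ≡ 0ℤ
  tail zero    p _        = ⊛-zeroˡ g n λ m → p (suc m) (s≤s z≤n)
  tail (suc a) p (s≤s lt) = degree-⊛ a (λ m → p (suc m) ∘ s≤s) r n lt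

-- Product formulas for signed counts.

module Counting (L : ℕ) where

  open Truncated L using (ring; constants)
  module R = CommutativeRing ring
  open R using (_≈_)
  open import Algebra.Properties.Ring R.ring using (-‿distribˡ-*)
  open import Algebra.Properties.Semiring.Exp R.semiring using (_^_)
  open Identities ring constants using (∏; ∑; ∏-cong; ∑-cong; ∑-*ʳ; ∏-ones; ∏-pairs; ∏-+)
  open import Relation.Binary.Reasoning.Setoid R.setoid

  q^-⊛-+ : ∀ p f n → (q ^ p ⊛ f) (p + n) ≡ f n
  q^-⊛-+ zero    f n = trans (const-⊛ 1ℤ f n) (ℤ.*-identityˡ (f n))
  q^-⊛-+ (suc p) f n = trans (⊛-assoc q (q ^ p) f (suc (p + n)))
    (trans (q-⊛-suc (q ^ p ⊛ f) (p + n)) (q^-⊛-+ p f n))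

  q^-⊛-< : ∀ p f n → n < p → (q ^ p ⊛ f) n ≡ 0ℤ
  q^-⊛-< (suc p) f zero    _         = trans (⊛-assoc q (q ^ p) f 0) refl
  q^-⊛-< (suc p) f (suc n) (s≤s n<p) = trans (⊛-assoc q (q ^ p) f (suc n))
    (trans (q-⊛-suc (q ^ p ⊛ f) n) (q^-⊛-< p f n n<p))

  -- The series 1/(1-q^p) for p ≥ 1, given by its coefficients.
  geometric : ℕ → Series
  geometric p n = if does (p ∣? n) then 1ℤ else 0ℤ

  geometric-step : ∀ i n → geometric (suc i) n ≡ const 1ℤ n ℤ.+ (q ^ suc i ⊛ geometric (suc i)) n
  geometric-step i n with n <? suc i
  ... | yes n<p = trans (small n n<p) (trans (sym (ℤ.+-identityʳ (const 1ℤ n)))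
          (cong (λ z → const 1ℤ n ℤ.+ z) (sym (q^-⊛-< (suc i) (geometric (suc i)) n n<p))))
    where
    small : ∀ n → n < suc i → geometric (suc i) n ≡ const 1ℤ n
    small zero    _   = cong (if_then 1ℤ else 0ℤ) (dec-true (suc i ∣? 0) (suc i ∣0))
    small (suc n) n<p = cong (if_then 1ℤ else 0ℤ) (dec-false (suc i ∣? suc n) (>⇒∤ n<p))
  ... | no n≮p with m≤n⇒∃[o]m+o≡n (≮⇒≥ n≮p)
  ...   | m , refl = trans periodic (trans (sym (q^-⊛-+ (suc i) (geometric (suc i)) m)) (sym (ℤ.+-identityˡ _)))
    where
    periodic : geometric (suc i) (suc i + m) ≡ geometric (suc i) m
    periodic = cong (if_then 1ℤ else 0ℤ) (does-⇔
      (mk⇔ (λ ∣s → ∣m+n∣m⇒∣n ∣s ∣-refl) (∣m∣n⇒∣m+n ∣-refl)) (suc i ∣? suc i + m) (suc i ∣? m))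

  -- `Q?` selects the parts that contribute a sign: the even ones for B, those above 2ℓ for C, none
  -- for D.
  module Parts {Q : Pred ℕ 0ℓ} (Q? : Decidable Q) where

    sign : List ℕ → Parity
    sign xs = parity (length (filter Q? xs))

    factor : ℕ → Series
    factor p = if does (Q? p) then ⊖ (q ^ p) else q ^ p

    -- gf i m belongs to the part i+1, since 0 occurs as a part only with fixed multiplicity.
    gf : ℕ → Mode → Series
    gf i (exactly j) = factor (suc i) ^ j
    gf i (atLeast j) = factor (suc i) ^ j ⊛ geometric (suc i)
    gf i once        = const 1ℤ ⊕ factor (suc i)

    -- The sign class that the remaining parts must have once a part p is removed.
    twist : ℕ → Parity → Parity
    twist p π = if does (Q? p) then π ⁻¹ else π

    sign-∷ : ∀ p xs → sign xs ≡ twist p (sign (p ∷ xs))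
    sign-∷ p xs with Q? p
    ... | yes _ = sym (ℙ.suc-homo-⁻¹ (length (filter Q? xs)))
    ... | no _  = refl

    twist-involutive : ∀ p π → twist p (twist p π) ≡ π
    twist-involutive p π with Q? p
    ... | yes _ = ℙ.⁻¹-involutive π
    ... | no _  = refl

    Consed : ℕ → (ℕ → Parity → Pred (List ℕ) 0ℓ) → ℕ → Parity → Pred (List ℕ) 0ℓ
    Consed p Z n π λs = ∃₂ λ n′ λs′ → n ≡ p + n′ × λs ≡ p ∷ λs′ × Z n′ (twist p π) λs′

    factor-⊛ : ∀ p f n → (factor p ⊛ f) n ≡ (if does (Q? p) then ℤ.- (q ^ p ⊛ f) n else (q ^ p ⊛ f) n)
    factor-⊛ p f n with Q? p
    ... | no _  = refl
    -- An exact statement about coefficient n is read off from the ring truncated at that same n.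
    ... | yes _ = sym (neg-distribˡ (q ^ p) f n ≤-refl)
      where open import Algebra.Properties.Ring (CommutativeRing.ring (Truncated.ring n))
              using () renaming (-‿distribˡ-* to neg-distribˡ)

    twisted-count : ∀ p {A : Set} {P : Parity → Pred A 0ℓ} {z} → SignedCount P z →
                    SignedCount (λ π → P (twist p π)) (if does (Q? p) then ℤ.- z else z)
    twisted-count p c with Q? p
    ... | yes _ = signed-flip c
    ... | no _  = c

    -- Counts of `Z` are requested only at n - p, so that `geometric-count` can supply them by
    -- recursion on n.
    consed-count : ∀ p {Z f} n → (∀ n′ → n ≡ p + n′ → SignedCount (Z n′) (f n′)) →
                   SignedCount (Consed p Z n) ((factor p ⊛ f) n)
    consed-count p {Z} {f} n c rewrite factor-⊛ p f n with n <? p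
    ... | yes n<p = signed-cast id id (sym vanish) (signed-none {P = Consed p Z n} λ { (n′ , _ , refl , _) → m+n≮m p n′ n<p })
      where
      vanish : (if does (Q? p) then ℤ.- (q ^ p ⊛ f) n else (q ^ p ⊛ f) n) ≡ 0ℤ
      vanish rewrite q^-⊛-< p f n n<p with Q? p
      ... | no _  = refl
      ... | yes _ = refl
    ... | no n≮p with m≤n⇒∃[o]m+o≡n (≮⇒≥ n≮p)
    ...   | n′ , refl rewrite q^-⊛-+ p f n′ =
      signed-image (p ∷_) (λ { refl → refl }) (λ z → n′ , _ , refl , refl , z)
        (λ { (n″ , λs′ , eq , refl , z) → λs′ , refl , subst (λ m → Z m _ λs′) (sym (+-cancelˡ-≡ p n′ n″ eq)) z })
        (twisted-count p {P = Z n′} (c n′ refl))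

    -- Zero parts do not change the sum, so their number has to be fixed for the count to be finite.
    -- A part of unbounded multiplicity has to be unsigned, since signed copies would produce
    -- 1/(1+q^p) in place of `geometric`.
    module Modes (μ : ℕ → Mode) (zeros : ℕ) (μ-zero : μ 0 ≡ exactly zeros)
      (zeros-even : sign (replicate zeros 0) ≡ 0ℙ)
      (unsigned : ∀ p {j} → μ p ≡ atLeast j → ¬ Q p) where

      Fits : ℕ → Pred (List ℕ) 0ℓ
      Fits N λs = Linked _≥_ λs × All (_≤ N) λs × (∀ p → p ≤ N → Ok (μ p) (count p λs))

      Family : ℕ → ℕ → Parity → Pred (List ℕ) 0ℓ
      Family N n π λs = Fits N λs × sum λs ≡ n × sign λs ≡ π

      -- The condition m on the largest admissible part N+1 is a parameter detached from `μ`, so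
      -- that it can weaken as copies of N+1 are peeled off.
      TopFamily : ℕ → Mode → ℕ → Parity → Pred (List ℕ) 0ℓ
      TopFamily N m n π λs =
        (Linked _≥_ λs × All (_≤ suc N) λs × Ok m (count (suc N) λs) × (∀ p → p ≤ N → Ok (μ p) (count p λs)))
        × sum λs ≡ n × sign λs ≡ π

      top-absent : ∀ {N} λs → All (_≤ N) λs → count (suc N) λs ≡ 0
      top-absent λs ≤N = ∉⇒count≡0 λs λ N+1∈ → 1+n≰n (All.lookup ≤N N+1∈)

      skip : ∀ {N n π λs} m → Ok m 0 → Family N n π λs → TopFamily N m n π λs
      skip {λs = λs} m ok ((linked , ≤N , oks) , rest) =
        (linked , All.map m≤n⇒m≤1+n ≤N , subst (Ok m) (sym (top-absent λs ≤N)) ok , oks) , rest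

      take : ∀ {N n π λs} m m′ → (∀ c → Ok m′ c → Ok m (suc c)) →
             Consed (suc N) (TopFamily N m′) n π λs → TopFamily N m n π λs
      take {N} {π = π} m m′ ok (_ , λs′ , refl , refl , (linked , ≤N+1 , top , oks) , refl , s) =
        (Linked≥ ≤N+1 linked , ≤-refl ∷ ≤N+1 , subst (Ok m) (sym (count-here (suc N) λs′)) (ok _ top)
          , λ p p≤N → subst (Ok (μ p)) (sym (count-there (suc N) λs′ λ { refl → 1+n≰n p≤N })) (oks p p≤N))
        , refl , trans (sym (twist-involutive (suc N) _))
                   (trans (cong (twist (suc N)) (trans (sym (sign-∷ (suc N) λs′)) s)) (twist-involutive (suc N) π))
        where
        Linked≥ : ∀ {xs} → All (_≤ suc N) xs → Linked _≥_ xs → Linked _≥_ (suc N ∷ xs)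
        Linked≥ {[]}    _       _ = [-]
        Linked≥ {_ ∷ _} (p ∷ _) l = p ∷ l

      -- In a weakly decreasing list the part N+1 either stands at the head or does not occur.
      split : ∀ {N n π λs} m m′ → (∀ c → Ok m (suc c) → Ok m′ c) → TopFamily N m n π λs →
              (Ok m 0 × Family N n π λs) ⊎ Consed (suc N) (TopFamily N m′) n π λs
      split {λs = []} m m′ _ (([] , [] , top , oks) , rest) = inj₁ (top , ([] , [] , oks) , rest)
      split {N} {λs = x ∷ λs} m m′ ok ((linked , x≤N+1 ∷ ≤N+1 , top , oks) , refl , s) with x ≟ suc N
      ... | yes refl = inj₂ (sum λs , λs , refl , refl ,
              ( Linked.tail linked , ≤N+1
              , ok _ (subst (Ok m) (count-here (suc N) λs) top)
              , λ p p≤N → subst (Ok (μ p)) (count-there (suc N) λs λ { refl → 1+n≰n p≤N }) (oks p p≤N))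
              , refl , trans (sign-∷ (suc N) λs) (cong (twist (suc N)) s))
      ... | no x≢N+1 = inj₁ (subst (Ok m) (top-absent (x ∷ λs) ≤N) top , (linked , ≤N , oks) , refl , s)
        where
        x≤N : x ≤ N
        x≤N = ≤-pred (≤∧≢⇒< x≤N+1 x≢N+1)
        ≤N : All (_≤ N) (x ∷ λs)
        ≤N = Linked.Linked⇒All (λ a≥b b≥c → ≤-trans b≥c a≥b) x≤N linked

      skip-xor-take : ∀ {N Z n π λs} → Family N n π λs → ¬ Consed (suc N) Z n π λs
      skip-xor-take ((_ , N+1≤N ∷ _ , _) , _) (_ , _ , _ , refl , _) = 1+n≰n N+1≤N

      module _ {N} {W : Series} (lower : ∀ n → SignedCount (Family N n) (W n)) where

        exactly-count : ∀ j n → SignedCount (TopFamily N (exactly j) n) ((factor (suc N) ^ j ⊛ W) n)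
        exactly-count zero n = signed-cast (skip (exactly 0) refl)
          (λ t → case split (exactly 0) (exactly 0) (λ _ ()) t of λ { (inj₁ (_ , f)) → f ; (inj₂ (_ , λs′ , _ , refl , _)) →
            case trans (sym (proj₁ (proj₂ (proj₂ (proj₁ t))))) (count-here (suc N) λs′) of λ () })
          (sym (trans (const-⊛ 1ℤ W n) (ℤ.*-identityˡ (W n)))) (lower n)
        exactly-count (suc j) n = signed-cast (take (exactly (suc j)) (exactly j) λ { _ refl → refl })
          (λ t → case split (exactly (suc j)) (exactly j) (λ { _ refl → refl }) t of λ { (inj₁ (() , _)) ; (inj₂ c) → c })
          (sym (⊛-assoc (factor (suc N)) (factor (suc N) ^ j) W n))
          (consed-count (suc N) {Z = TopFamily N (exactly j)} n λ n′ _ → exactly-count j n′)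

        once-count : ∀ n → SignedCount (TopFamily N once n) (((const 1ℤ ⊕ factor (suc N)) ⊛ W) n)
        once-count n = signed-cast id id (sym (⊛-distribʳ W (const 1ℤ) (factor (suc N)) n))
          (signed-union (skip-xor-take {Z = TopFamily N (exactly 0)}) (skip once z≤n)
            (take once (exactly 0) λ { _ refl → ≤-refl })
            (λ t → case split once (exactly 0) (λ { _ (s≤s z≤n) → refl }) t of λ { (inj₁ (_ , f)) → inj₁ f ; (inj₂ c) → inj₂ c })
            (signed-cast id id (sym (trans (const-⊛ 1ℤ W n) (ℤ.*-identityˡ (W n)))) (lower n))
            (consed-count (suc N) {Z = TopFamily N (exactly 0)} n λ n′ _ →
              signed-cast id id (trans (const-⊛ 1ℤ W n′) (ℤ.*-identityˡ (W n′))) (exactly-count 0 n′)))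

        module _ (¬signed : ¬ Q (suc N)) where

          -- Peeling one copy of N+1 mirrors GW = W + q^{N+1} GW. The sum drops by at least one,
          -- hence the well-founded recursion on n.
          geometric-count : ∀ n → SignedCount (TopFamily N (atLeast 0) n) ((geometric (suc N) ⊛ W) n)
          geometric-count = <-rec _ λ n rec → signed-cast id id (sym (unfold n))
            (signed-union (skip-xor-take {Z = TopFamily N (atLeast 0)}) (skip (atLeast 0) z≤n)
              (take (atLeast 0) (atLeast 0) λ _ _ → z≤n)
              (λ t → case split (atLeast 0) (atLeast 0) (λ _ _ → z≤n) t of λ { (inj₁ (_ , f)) → inj₁ f ; (inj₂ c) → inj₂ c })
              (lower n)
              (consed-count (suc N) {Z = TopFamily N (atLeast 0)} n λ { n′ refl → rec (s≤s (m≤n+m n′ N)) }))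
            where
            G = geometric (suc N)
            unfold : ∀ n → (G ⊛ W) n ≡ W n ℤ.+ (factor (suc N) ⊛ (G ⊛ W)) n
            unfold n with Q? (suc N)
            ... | yes qN = contradiction qN ¬signed
            ... | no _   = trans (⊛-cong {g = W} n (λ m _ → geometric-step N m) (λ _ _ → refl))
              (trans (⊛-distribʳ W (const 1ℤ) (q ^ suc N ⊛ G) n)
                (cong₂ ℤ._+_ (trans (const-⊛ 1ℤ W n) (ℤ.*-identityˡ (W n))) (⊛-assoc (q ^ suc N) G W n)))

          atLeast-count : ∀ j n → SignedCount (TopFamily N (atLeast j) n) ((factor (suc N) ^ j ⊛ geometric (suc N) ⊛ W) n)
          atLeast-count zero n = signed-cast id id
            (sym (trans (⊛-assoc (const 1ℤ) (geometric (suc N)) W n) (trans (const-⊛ 1ℤ _ n) (ℤ.*-identityˡ _))))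
            (geometric-count n)
          atLeast-count (suc j) n = signed-cast (take (atLeast (suc j)) (atLeast j) λ _ → s≤s)
            (λ t → case split (atLeast (suc j)) (atLeast j) (λ { _ (s≤s j≤c) → j≤c }) t of λ { (inj₁ (() , _)) ; (inj₂ c) → c })
            (sym (trans (⊛-assoc (x ⊛ (x ^ j)) G W n) (trans (⊛-assoc x (x ^ j) (G ⊛ W) n)
              (⊛-cong {f = x} n (λ _ _ → refl) λ m _ → sym (⊛-assoc (x ^ j) G W m)))))
            (consed-count (suc N) {Z = TopFamily N (atLeast j)} n λ n′ _ → atLeast-count j n′)
            where
            x = factor (suc N)
            G = geometric (suc N)

        top-count : ∀ m → (∀ {j} → m ≡ atLeast j → ¬ Q (suc N)) → ∀ n → SignedCount (TopFamily N m n) ((gf N m ⊛ W) n)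
        top-count (exactly j) _ = exactly-count j
        top-count (atLeast j) u = atLeast-count (u refl) j
        top-count once        _ = once-count

      family-count : ∀ N n → SignedCount (Family N n) (∏ N (λ i → gf i (μ (suc i))) n)
      family-count zero n = base n
        where
        zeros-linked : ∀ z → Linked _≥_ (replicate z 0)
        zeros-linked zero          = []
        zeros-linked (suc zero)    = [-]
        zeros-linked (suc (suc z)) = z≤n ∷ zeros-linked (suc z)
        zeros≤ : ∀ z → All (_≤ 0) (replicate z 0)
        zeros≤ zero    = []
        zeros≤ (suc z) = z≤n ∷ zeros≤ z
        sum-zeros : ∀ z → sum (replicate z 0) ≡ 0
        sum-zeros zero    = refl
        sum-zeros (suc z) = sum-zeros z
        count-zeros : ∀ z → count 0 (replicate z 0) ≡ z
        count-zeros zero    = refl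
        count-zeros (suc z) = trans (count-here 0 (replicate z 0)) (cong suc (count-zeros z))
        zeros⁻ : ∀ λs → All (_≤ 0) λs → λs ≡ replicate (count 0 λs) 0
        zeros⁻ []       []        = refl
        zeros⁻ (_ ∷ λs) (z≤n ∷ ≤0) = cong (0 ∷_) (zeros⁻ λs ≤0)
        fits-zero : ∀ {λs} → Fits 0 λs → λs ≡ replicate zeros 0
        fits-zero {λs} (_ , ≤0 , oks) = trans (zeros⁻ λs ≤0)
          (cong (λ z → replicate z 0) (subst (λ m → Ok m (count 0 λs)) μ-zero (oks 0 z≤n)))
        zeros-fit : Fits 0 (replicate zeros 0)
        zeros-fit = zeros-linked zeros , zeros≤ zeros
                  , λ { 0 z≤n → subst (λ m → Ok m (count 0 (replicate zeros 0))) (sym μ-zero) (count-zeros zeros) }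
        base : ∀ n → SignedCount (Family 0 n) (const 1ℤ n)
        base zero = signed
          (record { elements = replicate zeros 0 ∷ []
                  ; unique   = [] ∷ []
                  ; sound    = λ { (here refl) → zeros-fit , sum-zeros zeros , zeros-even }
                  ; complete = λ (f , _) → here (fits-zero f) })
          (none λ (f , _ , s) → case trans (sym s) (trans (cong sign (fits-zero f)) zeros-even) of λ ())
          refl
        base (suc n) = signed-none λ { {π} {λs} (f , s , _) →
          case trans (sym s) (trans (cong sum (fits-zero f)) (sum-zeros zeros)) of λ () }
      family-count (suc N) n = signed-cast
        (λ ((l , ≤N , top , oks) , rest) →
          (l , ≤N , λ p p≤ → case m≤n⇒m<n∨m≡n p≤ of λ { (inj₁ (s≤s p≤N)) → oks p p≤N ; (inj₂ refl) → top }) , rest)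
        (λ ((l , ≤N , oks) , rest) → (l , ≤N , oks (suc N) ≤-refl , λ p → oks p ∘ m≤n⇒m≤1+n) , rest)
        (⊛-comm (gf N (μ (suc N))) _ n)
        (top-count (family-count N) (μ (suc N)) (unsigned (suc N)) n)

  G : ℕ → Series
  G i = geometric (suc i)

  const-zero : ∀ n → const 0ℤ n ≡ 0ℤ
  const-zero zero    = refl
  const-zero (suc n) = refl

  truncation : q ^ suc L ≈ const 0ℤ
  truncation n n≤L = trans (sym (R.*-identityʳ (q ^ suc L) n n≤L))
    (trans (q^-⊛-< (suc L) (const 1ℤ) n (s≤s n≤L)) (sym (const-zero n)))

  G-inverse : ∀ i → (const 1ℤ ⊕ ⊖ (q ^ suc i)) ⊛ G i ≈ const 1ℤ
  G-inverse i = begin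
    (const 1ℤ ⊕ ⊖ (q ^ suc i)) ⊛ G i
      ≈⟨ R.distribʳ (G i) (const 1ℤ) (⊖ (q ^ suc i)) ⟩
    const 1ℤ ⊛ G i ⊕ (⊖ (q ^ suc i)) ⊛ G i
      ≈⟨ R.+-cong (R.*-identityˡ (G i)) (R.sym (-‿distribˡ-* (q ^ suc i) (G i))) ⟩
    G i ⊕ ⊖ (q ^ suc i ⊛ G i)
      ≈⟨ (λ n _ → trans (cong (ℤ._- (q ^ suc i ⊛ G i) n) (geometric-step i n)) (cancel (const 1ℤ n) ((q ^ suc i ⊛ G i) n))) ⟩
    const 1ℤ ∎
    where
    cancel : ∀ a b → a ℤ.+ b ℤ.- b ≡ a
    cancel a b = trans (ℤ.+-assoc a b (ℤ.- b)) (trans (cong (λ z → a ℤ.+ z) (ℤ.+-inverseʳ b)) (ℤ.+-identityʳ a))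

  open Identities.Sums ring constants q L G truncation G-inverse

  -- Summation over i is legitimate because x determines i: through the smallest part for D, through
  -- the largest odd part for B, and as a component of the pair for C.
  signed-∑ : ∀ {A : Set} {P : ℕ → Parity → Pred A 0ℓ} {F : ℕ → Series} k n →
             (∀ {i j π ρ x} → i < n → j < n → P i π x → P j ρ x → i ≡ j) → (∀ i → SignedCount (P i) (F i k)) →
             SignedCount (λ π x → ∃ λ i → i < n × P i π x) (∑ n F k)
  signed-∑ k zero disjoint c = signed-cast id id (sym (const-zero k)) (signed-none λ ())
  signed-∑ k (suc n) disjoint c = signed-union
    (λ (i , i<n , p) p′ → <-irrefl (disjoint (m<n⇒m<1+n i<n) ≤-refl p p′) i<n)
    (λ (i , i<n , p) → i , m<n⇒m<1+n i<n , p)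
    (λ p → n , ≤-refl , p)
    (λ { (i , s≤s i≤n , p) → case m≤n⇒m<n∨m≡n i≤n of λ { (inj₁ i<n) → inj₁ (i , i<n , p) ; (inj₂ refl) → inj₂ p } })
    (signed-∑ k n (λ i<n j<n → disjoint (m<n⇒m<1+n i<n) (m<n⇒m<1+n j<n)) c) (c n)

  -- The generating function of D.

  module CountD (j m : ℕ) where

    open Parts never? public

    sign-even : ∀ xs → sign xs ≡ 0ℙ
    sign-even xs = cong (parity ∘ length) (filter-none never? {xs = xs} (All.tabulate λ _ ()))

    open Modes (modeD j m) (zeros j m) (modeD-zero j m) (sign-even (replicate (zeros j m) 0)) (λ _ _ → id) public

  open CountD using () renaming (Family to FamilyD)

  module _ (κ : ℕ) where

    private j = 2 * suc κ

    HasSmallest : ℕ → List ℕ → Set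
    HasSmallest m λs = Smallest m λs × count m λs ≡ j × Unique (filter (λ p → ¬? (p ≟ m)) λs)

    dPartition⇒family : ∀ {λs} → DPartition j L λs → ∃ λ m → m < suc L × FamilyD j m L L 0ℙ λs
    dPartition⇒family {λs} (pz@(linked , Σ≡L) , m , (m∈ , m≤) , j-times , unique) =
      m , s≤s (part≤ λs pz m∈) , (linked , All.tabulate (part≤ λs pz) , oks) , Σ≡L , CountD.sign-even j m λs
      where
      oks : ∀ p → p ≤ L → Ok (modeD j m p) (count p λs)
      oks p _ with <-cmp p m
      ... | tri< p<m _ _   = ∉⇒count≡0 λs λ p∈ → <⇒≱ p<m (All.lookup m≤ p∈)
      ... | tri≈ _ refl _  = j-times
      ... | tri> _ p≢m _   = unique⇒count≤1 (λ p → ¬? (p ≟ m)) λs unique p≢m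

    family⇒smallest : ∀ {m π λs} → m < suc L → FamilyD j m L L π λs → HasSmallest m λs
    family⇒smallest {m} {π} {λs} (s≤s m≤L) ((_ , ≤L , oks) , _ , _) =
      (count≥1⇒∈ λs (subst (1 ≤_) (sym j-times) (s≤s z≤n)) , All.tabulate m≤) , j-times
      , count≤1⇒unique (λ p → ¬? (p ≟ m)) λs rest
      where
      ok : ∀ {p μ} → p ≤ L → modeD j m p ≡ μ → Ok μ (count p λs)
      ok {p} p≤L refl = oks p p≤L
      j-times : count m λs ≡ j
      j-times = ok m≤L (modeD-≡ refl)
      m≤ : ∀ {p} → p ∈ λs → m ≤ p
      m≤ {p} p∈ with m ≤? p
      ... | yes m≤p = m≤p
      ... | no m≰p  = contradiction (∈⇒count≥1 λs p∈)
              (<⇒≱ (s≤s (≤-reflexive (ok (All.lookup ≤L p∈) (modeD-< (≰⇒> m≰p))))))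
      rest : ∀ p → p ≢ m → count p λs ≤ 1
      rest p p≢m with p ≤? L
      ... | no p≰L = ≤-trans (≤-reflexive (beyond λs ≤L (≰⇒> p≰L))) z≤n
      ... | yes p≤L with <-cmp p m
      ...   | tri< p<m _ _ = ≤-trans (≤-reflexive (ok p≤L (modeD-< p<m))) z≤n
      ...   | tri≈ _ p≡m _ = contradiction p≡m p≢m
      ...   | tri> _ _ m<p = ok p≤L (modeD-> m<p)

    gfD : ℕ → ℕ → Series
    gfD n m = ∏ n (λ i → CountD.gf j m i (modeD j m (suc i)))

    D-count : + D j L ≡ ∑ (suc L) (gfD L) L
    -- D has no sign, so all its partitions go to the even class and the odd class is empty.
    D-count = signed-unique {P = λ π λs → DPartition j L λs × π ≡ 0ℙ}
      {Q = λ π λs → ∃ λ m → m < suc L × FamilyD j m L L π λs}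
      (λ { (d , refl) → let m , m< , f = dPartition⇒family d in m , m< , f })
      (λ { {_} {λs} (m , m< , f@((linked , _) , Σ≡L , s)) →
        ((linked , Σ≡L) , m , family⇒smallest m< f) , trans (sym s) (CountD.sign-even j m λs) })
      (signed (image id id (λ d → d , refl) (λ (d , _) → _ , refl , d) (dPartitions j L)) (none λ ())
        (trans (cong (λ z → + z ℤ.- + 0) (length-map id (Enumeration.elements (dPartitions j L)))) (ℤ.+-identityʳ _)))
      (signed-∑ L (suc L) (λ i< j< f g → smallest-unique (proj₁ (family⇒smallest i< f)) (proj₁ (family⇒smallest j< g)))
        (λ m → CountD.family-count j m L L))

    gfD-below : ∀ n m → n < m → gfD n m ≈ const 1ℤ
    gfD-below n m n<m = ∏-ones n λ i i<n → gf-≡ (modeD-< (≤-trans (s≤s i<n) n<m))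
      where
      gf-≡ : ∀ {i μ} → modeD j m (suc i) ≡ μ → CountD.gf j m i (modeD j m (suc i)) ≈ CountD.gf j m i μ
      gf-≡ refl = R.refl

    -- Admitting the part n+1 multiplies the summands with smallest part m ≤ n by 1+q^{n+1} and
    -- opens a new one at m = n+1, in which all smaller parts are excluded. This is the recursion of
    -- `dSum`.
    gfD-sum : ∀ n → ∑ (suc n) (gfD n) ≈ dSum j n
    gfD-sum zero    = R.+-identityˡ _
    gfD-sum (suc n) = begin
      ∑ (suc n) (gfD (suc n)) ⊕ gfD n (suc n) ⊛ CountD.gf j (suc n) n (modeD j (suc n) (suc n))
        ≈⟨ R.+-cong (∑-cong (suc n) λ m m≤n → R.*-congˡ (gf-≡ m (modeD-> m≤n)))
             (R.*-cong (gfD-below n (suc n) ≤-refl) (gf-≡ (suc n) (modeD-≡ refl))) ⟩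
      ∑ (suc n) (λ m → gfD n m ⊛ 1+q^ (suc n)) ⊕ const 1ℤ ⊛ ((q ^ suc n) ^ j)
        ≈⟨ R.+-cong (R.sym (∑-*ʳ (suc n) (gfD n) (1+q^ (suc n)))) (R.*-identityˡ _) ⟩
      ∑ (suc n) (gfD n) ⊛ 1+q^ (suc n) ⊕ (q ^ suc n) ^ j
        ≈⟨ R.+-congʳ (R.*-congʳ (gfD-sum n)) ⟩
      dSum j (suc n) ∎
      where
      gf-≡ : ∀ m {μ} → modeD j m (suc n) ≡ μ → CountD.gf j m n (modeD j m (suc n)) ≈ CountD.gf j m n μ
      gf-≡ m refl = R.refl

  -- The generating functions of B and C.

  module CountB (l : ℕ) where
    open Parts even? public
    open Modes (modeB l) 0 (modeB-zero l) refl (λ p → modeB-unsigned {l} {p}) public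

  module CountC (l : ℕ) where
    open Parts (2 * suc l <?_) public
    open Modes (modeC l) 0 refl refl (modeC-unsigned l) public

  module _ (κ : ℕ) where

    private k = suc κ

    FamilyB : ℕ → ℕ → Parity → Pred (List ℕ) 0ℓ
    FamilyB n l = CountB.Family l (top κ l) n

    ParametersB : ℕ → Parity → Pred (List ℕ) 0ℓ
    ParametersB l π λs = Largest (2 * suc l ∸ 1) (oddParts λs) × Exceptional k (suc l) π (evenParts λs)

    bPartition⇒family : ∀ {π n λs} → BPartition k π n λs → ∃ λ l → l < suc n × FamilyB n l π λs
    bPartition⇒family {π} {n} {λs} ((pz@(linked , Σ≡n) , positive) , suc l , _ , (2ℓ∸1∈ , odd≤) , _ , no-repeat , range , s) =
      -- The bound is relaxed to l < n+1 so that the sum has the same range as the one for C at n+1.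
      l , m<n⇒m<1+n l<n , (linked , All.tabulate ≤top , oks) , Σ≡n , s
      where
      2ℓ∸1∈λs : 2 * suc l ∸ 1 ∈ λs
      2ℓ∸1∈λs = proj₁ (∈-filter⁻ odd? {xs = λs} 2ℓ∸1∈)
      l<n : l < n
      l<n = ≤-trans (ℓ≤2ℓ∸1 (suc l)) (part≤ λs pz 2ℓ∸1∈λs)
      even-range : ∀ {p} → p ∈ λs → Even p → 2 * suc l + 2 ≤ p × p ≤ 2 * suc l + 2 * suc κ ∸ 2
      even-range p∈ e = All.lookup range (∈-filter⁺ even? p∈ e)
      odd-range : ∀ {p} → p ∈ λs → Odd p → p ≤ 2 * suc l ∸ 1
      odd-range p∈ o = All.lookup odd≤ (∈-filter⁺ odd? p∈ o)
      ≤top : ∀ {p} → p ∈ λs → p ≤ top κ l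
      ≤top {p} p∈ with even? p
      ... | yes e = ≤-trans (proj₂ (even-range p∈ e)) (≤-reflexive (range-top κ l))
      ... | no ¬e = ≤-trans (odd-range p∈ (¬even⇒odd p ¬e)) (≤-trans (m∸n≤m (2 * suc l) 1) (2ℓ≤top κ l))
      oks : ∀ p → p ≤ top κ l → Ok (modeB l p) (count p λs)
      oks p _ with even? p | 2 * suc l + 2 ≤? p | <-cmp p (2 * suc l ∸ 1)
      ... | yes e | yes _ | _            = unique⇒count≤1 even? λs no-repeat e
      ... | yes e | no ¬lo | _           = ∉⇒count≡0 λs λ p∈ → ¬lo (proj₁ (even-range p∈ e))
      ... | no _  | _     | tri< _ _ _   = z≤n
      ... | no _  | _     | tri≈ _ refl _ = ∈⇒count≥1 λs 2ℓ∸1∈λs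
      ... | no ¬e | _     | tri> p≯ _ p> = ∉⇒count≡0 λs λ p∈ → <⇒≱ p> (odd-range p∈ (¬even⇒odd p ¬e))

    family⇒parametersB : ∀ {n l π λs} → FamilyB n l π λs → All (1 ≤_) λs × ParametersB l π λs
    family⇒parametersB {n} {l} {π} {λs} ((_ , ≤top , oks) , _ , s) =
      All.tabulate positive
      , (∈-filter⁺ odd? (count≥1⇒∈ λs (ok 2ℓ∸1≤top (modeB-odd-≡ (2ℓ∸1-odd l) refl))) (2ℓ∸1-odd l)
        , All.tabulate λ p∈ → let p∈λs , o = ∈-filter⁻ odd? {xs = λs} p∈ in odd-range p∈λs o)
      , exceptional-length κ l _ no-repeat (All.tabulate λ p∈ → proj₂ (∈-filter⁻ even? {xs = λs} p∈)) range
      , no-repeat , range , s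
      where
      ok : ∀ {p μ} → p ≤ top κ l → modeB l p ≡ μ → Ok μ (count p λs)
      ok p≤ refl = oks _ p≤
      absent : ∀ {p} → p ∈ λs → modeB l p ≢ exactly 0
      absent {p} p∈ eq = <⇒≱ (∈⇒count≥1 λs p∈) (≤-reflexive (ok (All.lookup ≤top p∈) eq))
      2ℓ∸1≤top : 2 * suc l ∸ 1 ≤ top κ l
      2ℓ∸1≤top = ≤-trans (m∸n≤m (2 * suc l) 1) (2ℓ≤top κ l)
      positive : ∀ {p} → p ∈ λs → 1 ≤ p
      positive {zero}  0∈ = contradiction (modeB-zero l) (absent 0∈)
      positive {suc p} _  = s≤s z≤n
      odd-range : ∀ {p} → p ∈ λs → Odd p → p ≤ 2 * suc l ∸ 1
      odd-range p∈ o = ≮⇒≥ λ p> → absent p∈ (modeB-odd-> o p>)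
      range : All (λ p → 2 * suc l + 2 ≤ p × p ≤ 2 * suc l + 2 * suc κ ∸ 2) (evenParts λs)
      range = All.tabulate λ p∈ → let p∈λs , e = ∈-filter⁻ even? {xs = λs} p∈ in
        ≮⇒≥ (λ p< → absent p∈λs (modeB-even-< e p<))
        , ≤-trans (All.lookup ≤top p∈λs) (≤-reflexive (sym (range-top κ l)))
      no-repeat : Unique (evenParts λs)
      no-repeat = count≤1⇒unique even? λs at-most-once
        where
        at-most-once : ∀ p → Even p → count p λs ≤ 1
        at-most-once p e with p ≤? top κ l | 2 * suc l + 2 ≤? p
        ... | no p≰  | _      = ≤-trans (≤-reflexive (beyond λs ≤top (≰⇒> p≰))) z≤n
        ... | yes p≤ | yes lo = ok p≤ (modeB-even-≥ e lo)
        ... | yes p≤ | no ¬lo = ≤-trans (≤-reflexive (ok p≤ (modeB-even-< e (≰⇒> ¬lo)))) z≤n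

    FamilyC : ℕ → ℕ → Parity → Pred (List ℕ) 0ℓ
    FamilyC n l = CountC.Family l (top κ l) n

    cPair⇒family : ∀ {π n λs l} → CPair k π n (λs , suc l) → l < n × FamilyC n l π λs
    cPair⇒family {π} {n} {λs} {l} ((pz@(linked , Σ≡n) , positive) , _ , 2ℓ∈ , unique≤ , evens , _ , no-repeat , range , s) =
      ≤-trans (ℓ≤2ℓ (suc l)) (part≤ λs pz 2ℓ∈) , (linked , All.tabulate ≤top , oks) , Σ≡n , s
      where
      ≤top : ∀ {p} → p ∈ λs → p ≤ top κ l
      ≤top {p} p∈ with 2 * suc l <? p
      ... | yes p> = ≤-trans (proj₂ (All.lookup range (∈-filter⁺ (2 * suc l <?_) p∈ p>))) (≤-reflexive (range-top κ l))
      ... | no p≯  = ≤-trans (≮⇒≥ p≯) (2ℓ≤top κ l)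
      oks : ∀ p → p ≤ top κ l → Ok (modeC l p) (count p λs)
      oks zero _ = ∉⇒count≡0 λs λ 0∈ → case All.lookup positive 0∈ of λ ()
      oks (suc p) _ with suc p ≤? suc l | <-cmp (suc p) (2 * suc l) | even? (suc p)
      ... | yes p≤ | _             | _     = unique⇒count≤1 (_≤? suc l) λs unique≤ p≤
      ... | no _   | tri< _ _ _    | _     = z≤n
      ... | no _   | tri≈ _ p≡ _   | _     = ∈⇒count≥1 λs (subst (_∈ λs) (sym p≡) 2ℓ∈)
      ... | no _   | tri> _ _ p>   | yes _ = unique⇒count≤1 (2 * suc l <?_) λs no-repeat p>
      ... | no _   | tri> _ _ p>   | no ¬e = ∉⇒count≡0 λs λ p∈ → ¬e (All.lookup evens (∈-filter⁺ (2 * suc l <?_) p∈ p>))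

    family⇒cPair : ∀ {n l π λs} → FamilyC n l π λs → CPair k π n (λs , suc l)
    family⇒cPair {n} {l} {π} {λs} ((linked , ≤top , oks) , Σ≡n , s) =
      ((linked , Σ≡n) , All.tabulate positive) , s≤s z≤n
      , count≥1⇒∈ λs (at-2ℓ (2 * suc l) refl)
      , count≤1⇒unique (_≤? suc l) λs below , all-even
      , exceptional-length κ l _ no-repeat all-even range , no-repeat , range , s
      where
      ok : ∀ {p μ} → p ≤ top κ l → modeC l p ≡ μ → Ok μ (count p λs)
      ok p≤ refl = oks _ p≤
      absent : ∀ {p} → p ∈ λs → modeC l p ≢ exactly 0
      absent {p} p∈ eq = <⇒≱ (∈⇒count≥1 λs p∈) (≤-reflexive (ok (All.lookup ≤top p∈) eq))
      positive : ∀ {p} → p ∈ λs → 1 ≤ p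
      positive {zero}  0∈ = contradiction refl (absent 0∈)
      positive {suc p} _  = s≤s z≤n
      at-2ℓ : ∀ p → p ≡ 2 * suc l → 1 ≤ count p λs
      at-2ℓ (suc p) p≡ = ok (≤-trans (≤-reflexive p≡) (2ℓ≤top κ l)) (modeC-≡2ℓ (subst (suc l <_) (sym p≡) ℓ<2ℓ) p≡)
        where
        ℓ<2ℓ : suc l < 2 * suc l
        ℓ<2ℓ = m<m+n (suc l) (s≤s z≤n)
      at-most-once : ∀ p → (p ≤ top κ l → modeC l p ≡ once ⊎ modeC l p ≡ exactly 0) → count p λs ≤ 1
      at-most-once p mode with p ≤? top κ l
      ... | no p≰  = ≤-trans (≤-reflexive (beyond λs ≤top (≰⇒> p≰))) z≤n
      ... | yes p≤ with mode p≤
      ...   | inj₁ eq = ok p≤ eq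
      ...   | inj₂ eq = ≤-trans (≤-reflexive (ok p≤ eq)) z≤n
      below : ∀ p → p ≤ suc l → count p λs ≤ 1
      below zero    _   = at-most-once 0 λ _ → inj₂ refl
      below (suc p) p≤ℓ = at-most-once (suc p) λ _ → inj₁ (modeC-≤ℓ p≤ℓ)
      above-even : ∀ {p} → p ∈ λs → 2 * suc l < p → Even p
      above-even {suc p} p∈ p> with even? (suc p)
      ... | yes e = e
      ... | no ¬e = contradiction (modeC-odd p> (¬even⇒odd (suc p) ¬e)) (absent p∈)
      all-even : All Even (partsAbove (2 * suc l) λs)
      all-even = All.tabulate λ p∈ → let p∈λs , p> = ∈-filter⁻ (2 * suc l <?_) {xs = λs} p∈ in above-even p∈λs p>
      no-repeat : Unique (partsAbove (2 * suc l) λs)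
      no-repeat = count≤1⇒unique (2 * suc l <?_) λs above
        where
        above : ∀ p → 2 * suc l < p → count p λs ≤ 1
        above (suc p) p> = at-most-once (suc p) λ _ → case even? (suc p) of λ
          { (yes e) → inj₁ (modeC-even p> e) ; (no ¬e) → inj₂ (modeC-odd p> (¬even⇒odd (suc p) ¬e)) }
      range : All (λ p → 2 * suc l + 2 ≤ p × p ≤ 2 * suc l + 2 * suc κ ∸ 2) (partsAbove (2 * suc l) λs)
      range = All.tabulate λ p∈ → let p∈λs , p> = ∈-filter⁻ (2 * suc l <?_) {xs = λs} p∈ in
        bottom (above-even p∈λs p>) p> , ≤-trans (All.lookup ≤top p∈λs) (≤-reflexive (sym (range-top κ l)))
        where
        bottom : ∀ {p} → Even p → 2 * suc l < p → 2 * suc l + 2 ≤ p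
        bottom {p} e p> with m≤n⇒m<n∨m≡n p>
        ... | inj₁ p>′ = subst (_≤ p) (+-comm 2 (2 * suc l)) p>′
        ... | inj₂ refl = contradiction e (odd⇒¬even (suc (2 * suc l))
            (subst (Odd ∘ suc) (*-comm (suc l) 2) (odd-double (suc l))))

    gfB gfC : ℕ → Series
    gfB l = ∏ (top κ l) (λ i → CountB.gf l i (modeB l (suc i)))
    gfC l = ∏ (top κ l) (λ i → CountC.gf l i (modeC l (suc i)))

    B-count : ∀ n → + Bᵉ k n ℤ.- + Bᵒ k n ≡ ∑ (suc n) gfB n
    B-count n = signed-unique {P = λ π → BPartition k π n} {Q = λ π λs → ∃ λ l → l < suc n × FamilyB n l π λs}
      bPartition⇒family
      (λ (l , _ , f@((linked , _) , Σ≡n , _)) → let positive , parameters = family⇒parametersB f in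
        ((linked , Σ≡n) , positive) , suc l , s≤s z≤n , parameters)
      (signed (bPartitions k 0ℙ n) (bPartitions k 1ℙ n) refl)
      -- Equal largest odd parts 2ℓ-1 give equal ℓ; `cong suc` first undoes the subtraction.
      (signed-∑ n (suc n) (λ {i} {j} _ _ f g → suc-injective (*-cancelˡ-≡ (suc i) (suc j) 2 (cong suc
          (largest-unique (proj₁ (proj₂ (family⇒parametersB f))) (proj₁ (proj₂ (family⇒parametersB g)))))))
        (λ l → CountB.family-count l (top κ l) n))

    C-count : ∀ n → + Cᵉ k n ℤ.- + Cᵒ k n ≡ ∑ n gfC n
    C-count n = signed-unique {P = λ π → CPair k π n} {Q = λ π x → ∃ λ l → l < n × PairFamily l π x}
      (λ { {π} {λs , zero} (_ , () , _) ; {π} {λs , suc l} c → let l<n , f = cPair⇒family c in l , l<n , refl , f })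
      (λ { (_ , _ , refl , f) → family⇒cPair f })
      (signed (cPairs k 0ℙ n) (cPairs k 1ℙ n) refl)
      (signed-∑ n n (λ { _ _ (refl , _) (refl , _) → refl })
        (λ l → signed-image (_, suc l) (λ { refl → refl }) (λ f → refl , f) (λ { (refl , f) → _ , refl , f })
          (CountC.family-count l (top κ l) n)))
      where
      PairFamily : ℕ → Parity → Pred (List ℕ × ℕ) 0ℓ
      PairFamily l π (λs , ℓ) = ℓ ≡ suc l × FamilyC n l π λs

    bTerm : ℕ → Series
    bTerm l = q ^ suc (l * 2) ⊛ A (suc l) ⊛ evens κ (suc l * 2)

    -- Part sizes are grouped in pairs 2i+1, 2i+2. For i < l only the odd one contributes, for i = l
    -- it must occur, which adds q^{2ℓ-1}, and beyond that only the even one contributes, with a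
    -- sign.
    gfB≈bTerm : ∀ l → gfB l ≈ bTerm l
    gfB≈bTerm l = begin
      ∏ ((κ + suc l) * 2) f
        ≈⟨ ∏-pairs (κ + suc l) f ⟩
      ∏ (κ + suc l) pair
        ≈⟨ ∏-+ (suc l) κ pair ⟩
      ∏ l pair ⊛ pair l ⊛ ∏ κ (λ t → pair (t + suc l))
        ≈⟨ R.*-cong (R.*-cong (∏-cong l low) middle) (∏-cong κ high) ⟩
      A l ⊛ (q ^ suc (l * 2) ⊛ G (l * 2)) ⊛ evens κ (suc l * 2)
        ≈⟨ R.*-congʳ (R.trans (R.sym (R.*-assoc (A l) _ _)) (R.trans (R.*-congʳ (R.*-comm (A l) _)) (R.*-assoc _ (A l) _))) ⟩
      bTerm l ∎
      where
      f pair : ℕ → Series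
      f i = CountB.gf l i (modeB l (suc i))
      pair i = f (i * 2) ⊛ f (suc (i * 2))
      gf-≡ : ∀ i {μ} → modeB l (suc i) ≡ μ → f i ≈ CountB.gf l i μ
      gf-≡ i refl = R.refl
      2ℓ∸1 : suc (l * 2) ≡ 2 * suc l ∸ 1
      2ℓ∸1 = cong (_∸ 1) (*-comm (suc l) 2)
      unsigned : ∀ i → CountB.factor l (suc (i * 2)) ≈ q ^ suc (i * 2)
      unsigned i rewrite dec-false (even? (suc (i * 2))) (odd⇒¬even (suc (i * 2)) (odd-double i)) = R.refl
      no-even : ∀ i → i ≤ l → f (suc (i * 2)) ≈ const 1ℤ
      no-even i i≤l = gf-≡ (suc (i * 2)) (modeB-even-< (even-double i)
        (≤-trans (s≤s (*-monoˡ-≤ 2 (s≤s i≤l))) (≤-trans (n≤1+n _) (≤-reflexive (sym (range-bottom l))))))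
      low : ∀ i → i < l → pair i ≈ G (i * 2)
      low i i<l = R.trans (R.*-cong (R.trans (gf-≡ (i * 2) (modeB-odd-< (odd-double i)
          (≤-trans (s≤s (*-monoˡ-< 2 i<l)) (≤-reflexive 2ℓ∸1)))) (R.*-identityˡ _)) (no-even i (<⇒≤ i<l))) (R.*-identityʳ _)
      middle : pair l ≈ q ^ suc (l * 2) ⊛ G (l * 2)
      middle = R.trans (R.*-cong (R.trans (gf-≡ (l * 2) (modeB-odd-≡ (odd-double l) 2ℓ∸1))
          (R.*-congʳ (R.trans (R.*-identityʳ _) (unsigned l)))) (no-even l ≤-refl)) (R.*-identityʳ _)
      high : ∀ t → t < κ → pair (t + suc l) ≈ 1-q^ (2 + (t * 2 + suc l * 2))
      high t _ = R.trans (R.*-cong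
          (gf-≡ (i * 2) (modeB-odd-> (odd-double i)
            (≤-trans (s≤s (≤-reflexive (sym 2ℓ∸1))) (s≤s (<⇒≤ (*-monoˡ-≤ 2 (m≤n+m (suc l) t)))))))
          (R.trans (gf-≡ (suc (i * 2)) (modeB-even-≥ (even-double i)
            (≤-trans (≤-reflexive (range-bottom l)) (*-monoˡ-≤ 2 (s≤s (m≤n+m (suc l) t))))))
            signed-factor))
        (R.trans (R.*-identityˡ _) (R.reflexive (cong (λ m → 1-q^ (2 + m)) (*-distribʳ-+ 2 t (suc l)))))
        where
        i = t + suc l
        signed-factor : CountB.gf l (suc (i * 2)) once ≈ 1-q^ (2 + i * 2)
        signed-factor rewrite dec-true (even? (2 + i * 2)) (even-double i) = R.refl

    -- The sizes up to 2ℓ give q^{2ℓ} times `E ℓ`, hence a_ℓ; the larger ones, taken in pairs of an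
    -- excluded odd and a signed even size, give the finite product.
    gfC≈cTerm : ∀ l → gfC l ≈ cTerm κ l
    gfC≈cTerm l = begin
      ∏ (top κ l) f
        ≡⟨ cong (λ N → ∏ N f) (*-distribʳ-+ 2 κ (suc l)) ⟩
      ∏ (κ * 2 + suc l * 2) f
        ≈⟨ ∏-+ (suc l * 2) (κ * 2) f ⟩
      ∏ (suc l * 2) f ⊛ ∏ (κ * 2) (λ i → f (i + suc l * 2))
        ≈⟨ R.*-cong bottom (R.trans (∏-pairs κ _) (∏-cong κ high)) ⟩
      cTerm κ l ∎
      where
      f : ℕ → Series
      f i = CountC.gf l i (modeC l (suc i))
      gf-≡ : ∀ i {μ} → modeC l (suc i) ≡ μ → f i ≈ CountC.gf l i μ
      gf-≡ i refl = R.refl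
      unsigned : ∀ p → p ≤ 2 * suc l → CountC.factor l p ≈ q ^ p
      unsigned p p≤ rewrite dec-false (2 * suc l <? p) (≤⇒≯ p≤) = R.refl
      2ℓ : suc (l + suc l) ≡ 2 * suc l
      2ℓ = cong (λ m → suc l + suc m) (sym (+-identityʳ l))
      low : ∀ i → i < suc l → f i ≈ 1+q^ (suc i)
      low i i<ℓ = R.trans (gf-≡ i (modeC-≤ℓ i<ℓ)) (R.+-congˡ {const 1ℤ} (unsigned (suc i) (≤-trans i<ℓ (ℓ≤2ℓ (suc l)))))
      middle : ∀ i → i < l → f (i + suc l) ≈ G (i + suc l)
      middle i i<l = R.trans (gf-≡ (i + suc l) (modeC-<2ℓ (s≤s (m≤n+m (suc l) i))
        (≤-trans (s≤s (+-monoˡ-< (suc l) i<l)) (≤-reflexive 2ℓ)))) (R.*-identityˡ _)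
      last : f (l + suc l) ≈ q ^ suc (l + suc l) ⊛ G (l + suc l)
      last = R.trans (gf-≡ (l + suc l) (modeC-≡2ℓ (s≤s (m≤n+m (suc l) l)) 2ℓ))
        (R.*-congʳ (R.trans (R.*-identityʳ _) (unsigned (suc (l + suc l)) (≤-reflexive 2ℓ))))
      bottom : ∏ (suc l * 2) f ≈ q ^ (2 + l * 2) ⊛ A (suc l)
      bottom = begin
        ∏ (suc l * 2) f
          ≡⟨ cong (λ N → ∏ N f) (sym (trans 2ℓ (*-comm 2 (suc l)))) ⟩
        ∏ (l + suc l) f ⊛ f (l + suc l)
          ≈⟨ R.*-cong (∏-+ (suc l) l f) last ⟩
        ∏ (suc l) f ⊛ ∏ l (λ i → f (i + suc l)) ⊛ (w ⊛ G (l + suc l))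
          ≈⟨ R.*-congʳ (R.*-cong (∏-cong (suc l) low) (∏-cong l middle)) ⟩
        distinct (suc l) ⊛ H ⊛ (w ⊛ G (l + suc l))
          ≈⟨ R.*-congˡ (R.*-comm w _) ⟩
        distinct (suc l) ⊛ H ⊛ (G (l + suc l) ⊛ w)
          ≈⟨ R.*-assoc _ _ w ⟨
        distinct (suc l) ⊛ H ⊛ G (l + suc l) ⊛ w
          ≈⟨ R.*-comm _ w ⟩
        w ⊛ (distinct (suc l) ⊛ H ⊛ G (l + suc l))
          ≈⟨ R.*-cong (R.reflexive (cong (q ^_) (trans 2ℓ (*-comm 2 (suc l)))))
               (R.trans (R.*-assoc (distinct (suc l)) H _) (E≈A (suc l))) ⟩
        q ^ (2 + l * 2) ⊛ A (suc l) ∎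
        where
        w = q ^ suc (l + suc l)
        H = ∏ l (λ i → G (i + suc l))
      high : ∀ t → t < κ → f (t * 2 + suc l * 2) ⊛ f (suc (t * 2) + suc l * 2) ≈ 1-q^ (2 + (t * 2 + suc l * 2))
      high t _ = R.trans (R.*-cong (gf-≡ i (modeC-odd above (subst Odd (cong suc i≡) (odd-double (t + suc l)))))
          (R.trans (gf-≡ (suc i) (modeC-even (m<n⇒m<1+n above)
            (subst (Even ∘ suc ∘ suc) i≡ (even-double (t + suc l))))) signed-factor))
        (R.*-identityˡ _)
        where
        i = t * 2 + suc l * 2
        i≡ : (t + suc l) * 2 ≡ i
        i≡ = *-distribʳ-+ 2 t (suc l)
        above : 2 * suc l < suc i
        above = s≤s (≤-trans (≤-reflexive (*-comm 2 (suc l))) (m≤n+m (suc l * 2) (t * 2)))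
        signed-factor : CountC.gf l (suc i) once ≈ 1-q^ (2 + i)
        signed-factor rewrite dec-true (2 * suc l <? 2 + i) (m<n⇒m<1+n above) = R.refl

    q*gfB≈gfC : ∀ l → gfB l ⊛ q ≈ gfC l
    q*gfB≈gfC l = begin
      gfB l ⊛ q                                               ≈⟨ R.*-congʳ (gfB≈bTerm l) ⟩
      q ^ suc (l * 2) ⊛ A (suc l) ⊛ evens κ (suc l * 2) ⊛ q   ≈⟨ R.*-comm _ q ⟩
      q ⊛ (q ^ suc (l * 2) ⊛ A (suc l) ⊛ evens κ (suc l * 2)) ≈⟨ R.*-assoc q _ _ ⟨
      q ⊛ (q ^ suc (l * 2) ⊛ A (suc l)) ⊛ evens κ (suc l * 2) ≈⟨ R.*-congʳ (R.*-assoc q _ _) ⟨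
      cTerm κ l                                               ≈⟨ gfC≈cTerm l ⟨
      gfC l ∎

    ∑gfC≈cSum : ∑ L gfC ≈ cSum κ
    ∑gfC≈cSum = ∑-cong L λ l _ → gfC≈cTerm l

  2C+defect : ∀ κ → + D (2 * suc κ) L ≡ + 2 ℤ.* (+ Cᵉ (suc κ) L ℤ.- + Cᵒ (suc κ) L) ℤ.+ defect κ L
  2C+defect κ = trans (D-count κ) (trans (gfD-sum κ L L ≤-refl) (trans (cong (λ j → dSum j L L) (*-comm 2 (suc κ)))
    (trans (D≈2C+defect κ L ≤-refl) (cong (ℤ._+ defect κ L) (trans (const-⊛ (+ 2) (cSum κ) L)
      (cong (λ z → + 2 ℤ.* z) (trans (sym (∑gfC≈cSum κ L ≤-refl)) (sym (C-count κ L)))))))))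

  -- The degree of the defect.

  degree-q^ : ∀ p → Degree≤ p (q ^ p)
  degree-q^ zero    = degree-const 1ℤ
  degree-q^ (suc p) = degree-⊛ 1 degree-q (degree-q^ p)
    where
    degree-q : Degree≤ 1 q
    degree-q 1             (s≤s ())
    degree-q (suc (suc n)) _ = refl

  degree-1-q^ : ∀ p → Degree≤ p (1-q^ p)
  degree-1-q^ p = degree-⊕ (degree-const 1ℤ) (degree-⊖ (degree-q^ p))

  -- The exponents 2, 4, ..., 2k add up to k(k+1).
  degree-evens : ∀ k → Degree≤ (k * suc k) (evens k 0)
  degree-evens zero    = degree-const 1ℤ
  degree-evens (suc k) = degree-mono (≤-reflexive (lemma k))
    (degree-⊛ (k * suc k) (degree-evens k) (degree-1-q^ (2 + (k * 2 + 0))))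
    where
    lemma : ∀ k → k * suc k + (2 + (k * 2 + 0)) ≡ suc k * suc (suc k)
    lemma = ℕ.solve-∀

  -- With k = κ+1 the bound is k(2k-1); its growth to (k+1)(2k+1) is the degree 4k+1 of
  -- (1-q^{2k})(1-q^{2k+1}).
  degree-defect : ∀ κ → Degree≤ (suc κ * suc (κ * 2)) (defect κ)
  degree-defect zero    = degree-⊕ (degree-const 1ℤ) λ { 1 (s≤s ()) ; (suc (suc n)) _ → refl }
  degree-defect (suc κ) = degree-⊕
    (degree-mono (≤-reflexive (first κ))
      (degree-⊛ (2 + κ * 2) (degree-1-q^ (2 + κ * 2)) (degree-⊛ (3 + κ * 2) (degree-1-q^ (3 + κ * 2)) (degree-defect κ))))
    -- The inhomogeneous term has degree at most 2k+1+k(k+1), where k = κ+1, which falls short of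
    -- (k+1)(2k+1) by k².
    (degree-mono (≤-trans (m≤m+n _ (suc κ * suc κ)) (≤-reflexive (second κ)))
      (degree-⊛ 0 (degree-const (+ 2)) (degree-⊛ (3 + κ * 2) (degree-q^ (3 + κ * 2)) (degree-evens (suc κ)))))
    where
    first : ∀ κ → (2 + κ * 2) + ((3 + κ * 2) + suc κ * suc (κ * 2)) ≡ suc (suc κ) * suc (suc κ * 2)
    first = ℕ.solve-∀
    second : ∀ κ → (0 + ((3 + κ * 2) + suc κ * suc (suc κ))) + suc κ * suc κ ≡ suc (suc κ) * suc (suc κ * 2)
    second = ℕ.solve-∀

  D≡2C : ∀ κ → suc κ * suc (κ * 2) < L → + D (2 * suc κ) L ≡ + 2 ℤ.* (+ Cᵉ (suc κ) L - + Cᵒ (suc κ) L)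
  D≡2C κ large = trans (2C+defect κ)
    (trans (cong (λ z → + 2 ℤ.* (+ Cᵉ (suc κ) L - + Cᵒ (suc κ) L) ℤ.+ z) (degree-defect κ L large)) (ℤ.+-identityʳ _))

-- Comparison of coefficients n and n+1.

B≡C : ∀ κ n → + Bᵉ (suc κ) n ℤ.- + Bᵒ (suc κ) n ≡ + Cᵉ (suc κ) (suc n) ℤ.- + Cᵒ (suc κ) (suc n)
B≡C κ n = begin
  + Bᵉ (suc κ) n ℤ.- + Bᵒ (suc κ) n   ≡⟨ B-count κ n ⟩
  ∑ (suc n) (gfB κ) n                 ≡⟨ q-⊛-suc (∑ (suc n) (gfB κ)) n ⟨
  (q ⊛ ∑ (suc n) (gfB κ)) (suc n)     ≡⟨ R.trans (R.*-comm q _) (R.trans (∑-*ʳ (suc n) (gfB κ) q)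
                                           (∑-cong (suc n) λ l _ → q*gfB≈gfC κ l)) (suc n) ≤-refl ⟩
  ∑ (suc n) (gfC κ) (suc n)           ≡⟨ C-count κ (suc n) ⟨
  + Cᵉ (suc κ) (suc n) ℤ.- + Cᵒ (suc κ) (suc n) ∎
  where
  -- Truncation at n+1 keeps coefficient n of B and coefficient n+1 of C in one ring, where
  -- multiplication by q links them.
  open Counting (suc n)
  open Identities (Truncated.ring (suc n)) (Truncated.constants (suc n)) using (∑; ∑-*ʳ; ∑-cong)
  open ≡-Reasoning

half : ∀ {z d} → d ≡ + 2 ℤ.* z → z / 1 ≡ d / 2
half {z} {d} d≡2z = fromℚᵘ-cong {mkℚᵘ z 0} {mkℚᵘ d 1}
  (*≡* (trans (ℤ.*-comm z (+ 2)) (trans (sym d≡2z) (sym (ℤ.*-identityʳ d)))))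

open import Data.Nat using (_^_)

theorem3 : ∀ (k : ℕ) → 1 ≤ k → ∀ (n : ℕ) → n ≥ 2 ^ (k ∸ 1) * k * (2 * k ∸ 1) →
    (+ Bᵉ k n - + Bᵒ k n ≡ + Cᵉ k (n + 1) - + Cᵒ k (n + 1))
    × ((+ Cᵉ k (n + 1) - + Cᵒ k (n + 1)) / 1 ≡ + D (2 * k) (n + 1) / 2)
theorem3 (suc κ) _ n large = subst Conclusion (+-comm 1 n)
  -- The degree bound is at most n, hence strictly below the coefficient n+1 that is read off.
  (B≡C κ n , half (Counting.D≡2C (suc n) κ (s≤s (≤-trans degree≤ large))))
  where
  Conclusion : ℕ → Set
  Conclusion n′ = (+ Bᵉ (suc κ) n - + Bᵒ (suc κ) n ≡ + Cᵉ (suc κ) n′ - + Cᵒ (suc κ) n′)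
    × ((+ Cᵉ (suc κ) n′ - + Cᵒ (suc κ) n′) / 1 ≡ + D (2 * suc κ) n′ / 2)
  degree≤ : suc κ * suc (κ * 2) ≤ 2 ^ κ * suc κ * (2 * suc κ ∸ 1)
  -- As 2^{k-1} is positive, the bound on n dominates k(2k-1).
  degree≤ = *-mono-≤ (m≤n*m (suc κ) (2 ^ κ) {{m^n≢0 2 κ}}) (≤-reflexive (cong (_∸ 1) (*-comm (suc κ) 2)))
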